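{- Let $\alpha\in\omega+1$ and $T_{\alpha}=\mathrm{Th}(\mathfrak{M}_{\alpha})$. Then $T_{\alpha}$ admits quantifier elimination down to closure formulas: every $\mathcal{L}$-formula is equivalent modulo $T_{\alpha}$ to a closure formula.
   Context: $\mathcal{L}$ is the language with a single binary relation $R$, interpreted as a symmetric, anti-reflexive (graph) relation. For a finite graph $A$, the predimension is $\delta(A)=|A|-|R[A]|$, where $|R[A]|$ is the number of edges of $A$. $\mathcal{K}_{\omega}$ is the class of finite graphs $A$ with $\delta(B)>0$ for every non-empty $B\subseteq A$ (equivalently, finite acyclic graphs). For $n\geq 1$, $\mathcal{K}_{n}$ is the class of members of $\mathcal{K}_{\omega}$ in which every vertex $x$ of degree $\geq n+2$ is not the starting point of a path $x,y_1,\dots,y_{2n}$ of distinct vertices (a path of length $2n+1$ starting at $x$). $\mathcal{K}_{0}$ is the class of members of $\mathcal{K}_{\omega}$ all of whose vertices have degree $\leq 3$. All classes contain the empty graph. For finite $A\subseteq B$, $A$ is closed in $B$ (written $A\leq^{*}B$) if $\delta(C)>\delta(A)$ for every $C$ with $A\subsetneq C\subseteq B$; for a possibly infinite $M$, $A\leq^{*}M$ means $A\leq^{*}B$ for all finite $B$ with $A\subseteq B\subseteq M$. $B$ is an intrinsic extension of $A$ if $A\subseteq B$ and no proper substructure of $B$ containing $A$ is closed in $B$. The class $\langle\mathcal{K}_{\alpha},\leq^{*}\rangle$ has full (free) amalgamation, and $\mathfrak{M}_{\alpha}$ denotes its unique countable generic (Hrushovski–Fraïssé limit). For $\bar{a}\cong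 A$, $\mathrm{diag}_{A}(\bar{x})$ is the atomic diagram of $A$, and $\mathrm{diag}_{(A,B)}(\bar{x},\bar{y})$ is the atomic diagram of $B$ with $\bar{x}$ enumerating $A$ and $\bar{y}$ enumerating $B\setminus A$. The set of closure formulas is the least class of $\mathcal{L}$-formulas such that: (i) $\mathrm{diag}_{A}(\bar{x})$ is a closure formula for each $A\in\mathcal{K}_{\alpha}$; (ii) if $\varphi_{AB}(\bar{x}\bar{y})$ is a closure formula and $B\in\mathcal{K}_{\alpha}$ is an intrinsic extension of $A$, then $\exists\bar{y}[\mathrm{diag}_{(A,B)}(\bar{x},\bar{y})\wedge\varphi_{AB}(\bar{x}\bar{y})]$ is a closure formula; (iii) under the same conditions, $\forall\bar{y}[\mathrm{diag}_{(A,B)}(\bar{x},\bar{y})\rightarrow\varphi_{AB}(\bar{x}\bar{y})]$ is a closure formula; (iv) Boolean combinations of closure formulas are closure formulas. (So closure formulas are those whose quantifiers are relativized to closures.) -}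

module Defs where

open import Data.Nat using (ℕ; zero; suc; _+_; _*_; _≤_; _<_)
open import Data.Bool using (Bool; true; false; if_then_else_; _∧_)
open import Data.Fin using (Fin; zero; suc; toℕ; inject₁; _↑ʳ_)
import Data.Fin as Fin
open import Data.Fin.Subset using (Subset; _⊆_; _⊂_; Nonempty; ∣_∣; inside; outside)
import Data.Fin.Subset as Sub
open import Data.Vec using (Vec; replicate; _++_; lookup)
open import Data.Vec.Functional using (Vector) renaming (_∷_ to _◂_)
open import Data.List using (List; foldr; map; concatMap; allFin)
open import Data.Product using (Σ; ∃; _×_; _,_)
open import Data.Unit using (⊤)
open import Data.Empty using (⊥)
open import Data.Sum using (_⊎_)
open import Relation.Nullary using (¬_; does)
open import Relation.Binary.PropositionalEquality using (_≡_)
open import Function.Definitions using (Injective)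
import Data.Integer as Int

record FinGraph (n : ℕ) : Set where
  field
    adj    : Fin n → Fin n → Bool
    sym    : ∀ i j → adj i j ≡ adj j i
    irrefl : ∀ i → adj i i ≡ false
open FinGraph public

count : ∀ {A : Set} → (A → Bool) → List A → ℕ
count p = foldr (λ a r → if p a then suc r else r) 0

pairs : (n : ℕ) → List (Fin n × Fin n)
pairs n = concatMap (λ i → map (λ j → (i , j)) (allFin n)) (allFin n)

edges : ∀ {n} → FinGraph n → Subset n → ℕ
edges {n} G S = count (λ { (i , j) → (toℕ i Data.Nat.<ᵇ toℕ j) ∧ lookup S i ∧ lookup S j ∧ adj G i j }) (pairs n)

δ : ∀ {n} → FinGraph n → Subset n → Int.ℤ
δ G S = Int.+ ∣ S ∣ Int.- Int.+ edges G S

degree : ∀ {n} → FinGraph n → Fin n → ℕ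
degree {n} G x = count (adj G x) (allFin n)

data Alpha : Set where
  fin   : ℕ → Alpha
  omega : Alpha

Kω : ∀ {n} → FinGraph n → Set
Kω {n} G = (B : Subset n) → Nonempty B → Int.+ 0 Int.< δ G B

PathFrom : ∀ {n} → FinGraph n → ℕ → Fin n → Set
PathFrom {n} G N x =
  Σ (Fin (suc (N + N)) → Fin n) λ p →
    Injective _≡_ _≡_ p × (p zero ≡ x) ×
    ((i : Fin (N + N)) → adj G (p (inject₁ i)) (p (suc i)) ≡ true)

KN : ∀ {n} → ℕ → FinGraph n → Set
KN {n} N G = Kω G × ((x : Fin n) → N + 2 ≤ degree G x → ¬ PathFrom G N x)

K0 : ∀ {n} → FinGraph n → Set
K0 {n} G = Kω G × ((x : Fin n) → degree G x ≤ 3)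

K : Alpha → ∀ {n} → FinGraph n → Set
K (fin zero)    G = K0 G
K (fin (suc N)) G = KN (suc N) G
K omega         G = Kω G

Closed : ∀ {n} → FinGraph n → Subset n → Set
Closed G C = ∀ D → C ⊂ D → δ G C Int.< δ G D

base : (m k : ℕ) → Subset (m + k)
base m k = replicate m outside ++ replicate k inside

Intrinsic : ∀ m k → FinGraph (m + k) → Set
Intrinsic m k B = ∀ C → base m k ⊆ C → C ⊂ Sub.⊤ → ¬ Closed B C

record Graph : Set where
  field
    edge    : ℕ → ℕ → Bool
    esym    : ∀ a b → edge a b ≡ edge b a
    eirrefl : ∀ a → edge a a ≡ false
open Graph public

induced : ∀ {n} → Graph → (Fin n → ℕ) → FinGraph n
induced M a = record
  { adj = λ i j → edge M (a i) (a j)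
  ; sym = λ i j → esym M (a i) (a j)
  ; irrefl = λ i → eirrefl M (a i) }

-- predimension of a finite set of M enumerated without repetition by a
δM : ∀ {n} → Graph → (Fin n → ℕ) → Int.ℤ
δM M a = δ (induced M a) Sub.⊤

-- A ≤* M, A enumerated injectively by a: every finite C ⊋ A in M has δ(C) > δ(A)
ClosedIn : ∀ {n} → Graph → (Fin n → ℕ) → Set
ClosedIn {n} M a =
  ∀ p (c : Fin p → ℕ) → Injective _≡_ _≡_ c →
  (∀ i → ∃ λ j → c j ≡ a i) → n < p → δM M a Int.< δM M c

record Generic (α : Alpha) (M : Graph) : Set where
  field
    age  : ∀ n (a : Fin n → ℕ) → Injective _≡_ _≡_ a → K α (induced M a)
    rich : ∀ m k (B : FinGraph (m + k)) (a : Fin k → ℕ) →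
           Injective _≡_ _≡_ a →
           (∀ i j → edge M (a i) (a j) ≡ adj B (m ↑ʳ i) (m ↑ʳ j)) →
           ClosedIn M a → K α B → Closed B (base m k) →
           Σ (Fin (m + k) → ℕ) λ g →
             Injective _≡_ _≡_ g × (∀ i → g (m ↑ʳ i) ≡ a i) ×
             (∀ i j → edge M (g i) (g j) ≡ adj B i j) × ClosedIn M g

data Formula (n : ℕ) : Set where
  tt ff      : Formula n
  eq rel     : Fin n → Fin n → Formula n
  not        : Formula n → Formula n
  _and_ _or_ _imp_ : Formula n → Formula n → Formula n
  ex all     : Formula (suc n) → Formula n

infixr 6 _and_
infixr 5 _or_
infixr 4 _imp_

Sat : ∀ {n} → Graph → Vector ℕ n → Formula n → Set
Sat M ρ tt = ⊤
Sat M ρ ff = ⊥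
Sat M ρ (eq i j) = ρ i ≡ ρ j
Sat M ρ (rel i j) = edge M (ρ i) (ρ j) ≡ true
Sat M ρ (not φ) = ¬ Sat M ρ φ
Sat M ρ (φ and ψ) = Sat M ρ φ × Sat M ρ ψ
Sat M ρ (φ or ψ) = Sat M ρ φ ⊎ Sat M ρ ψ
Sat M ρ (φ imp ψ) = Sat M ρ φ → Sat M ρ ψ
Sat M ρ (ex φ) = Σ ℕ λ a → Sat M (a ◂ ρ) φ
Sat M ρ (all φ) = (a : ℕ) → Sat M (a ◂ ρ) φ

liftR : ∀ {k n} → (Fin k → Fin n) → Fin (suc k) → Fin (suc n)
liftR r zero = zero
liftR r (suc i) = suc (r i)

rename : ∀ {k n} → (Fin k → Fin n) → Formula k → Formula n
rename r tt = tt
rename r ff = ff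
rename r (eq i j) = eq (r i) (r j)
rename r (rel i j) = rel (r i) (r j)
rename r (not φ) = not (rename r φ)
rename r (φ and ψ) = rename r φ and rename r ψ
rename r (φ or ψ) = rename r φ or rename r ψ
rename r (φ imp ψ) = rename r φ imp rename r ψ
rename r (ex φ) = ex (rename (liftR r) φ)
rename r (all φ) = all (rename (liftR r) φ)

exs : ∀ m {k} → Formula (m + k) → Formula k
exs zero φ = φ
exs (suc m) φ = exs m (ex φ)

alls : ∀ m {k} → Formula (m + k) → Formula k
alls zero φ = φ
alls (suc m) φ = alls m (all φ)

diag : ∀ {n} → FinGraph n → Formula n
diag {n} G = foldr _and_ tt (map lit (pairs n))
  where
  lit : Fin n × Fin n → Formula n
  lit (i , j) = (if adj G i j then rel i j else not (rel i j))
            and (if does (i Fin.≟ j) then eq i j else not (eq i j))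

-- Closure formulas (for a fixed α).  Variables x̄ may be any tuple of
-- distinct variables of the context (rule `ren`); in `cex`/`call`
-- x̄ enumerates A (last k indices) and ȳ enumerates B ∖ A (first m).

data IsClosure (α : Alpha) : ∀ {n} → Formula n → Set where
  cdiag : ∀ {n} (A : FinGraph n) → K α A → IsClosure α (diag A)
  cex   : ∀ m k (B : FinGraph (m + k)) → K α B → Intrinsic m k B →
          (φ : Formula (m + k)) → IsClosure α φ →
          IsClosure α (exs m (diag B and φ))
  call  : ∀ m k (B : FinGraph (m + k)) → K α B → Intrinsic m k B →
          (φ : Formula (m + k)) → IsClosure α φ →
          IsClosure α (alls m (diag B imp φ))
  ren   : ∀ {k n} (r : Fin k → Fin n) → Injective _≡_ _≡_ r →
          (φ : Formula k) → IsClosure α φ → IsClosure α (rename r φ)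
  ctt   : ∀ {n} → IsClosure α {n} tt
  cff   : ∀ {n} → IsClosure α {n} ff
  cnot  : ∀ {n} {φ : Formula n} → IsClosure α φ → IsClosure α (not φ)
  cand  : ∀ {n} {φ ψ : Formula n} → IsClosure α φ → IsClosure α ψ → IsClosure α (φ and ψ)
  cor   : ∀ {n} {φ ψ : Formula n} → IsClosure α φ → IsClosure α ψ → IsClosure α (φ or ψ)
  cimp  : ∀ {n} {φ ψ : Formula n} → IsClosure α φ → IsClosure α ψ → IsClosure α (φ imp ψ)

{-# OPTIONS --safe #-}
module Submission where

-- In a forest, δ counts components, so a finite set is closed exactly when no edge leaves it,
-- and a connected one-point extension is intrinsic.  Consider the local back-and-forth game in
-- which every new vertex must be a neighbour of one already in play; its types of each length
-- are described by finitely many closure formulas.  It then suffices to show that local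
-- equivalence of length 2r + 1 allows one more unrestricted move followed by local equivalence of
-- length r.  A vertex close to the position is reached along a path.  A vertex far from it is
-- matched by approximating its part of the forest by a finite tree, whose disjoint copies embed as
-- unions of components by genericity; one of them misses the position.

open import Defs
open import Axiom.ExcludedMiddle using (ExcludedMiddle)
open import Data.Bool using (Bool; true; false; if_then_else_; _∧_)
open import Data.Bool.Properties using (∧-zeroʳ)
open import Data.Empty using (⊥; ⊥-elim)
open import Data.Fin using (Fin; zero; suc; toℕ; inject₁; _↑ˡ_; _↑ʳ_; splitAt)
import Data.Fin as Fin
open import Data.Fin.Properties
  using (splitAt-↑ˡ; splitAt-↑ʳ; splitAt⁻¹-↑ˡ; splitAt⁻¹-↑ʳ; toℕ-↑ˡ; toℕ-↑ʳ; ↑ˡ-injective; ↑ʳ-injective)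
import Data.Fin.Properties as Finₚ
open import Data.Fin.Subset using (Subset; ∣_∣; inside; outside; _⊆_; _∈_; _∉_)
import Data.Fin.Subset as Sub
import Data.Fin.Subset.Properties as Subₚ
import Data.Integer as Int
import Data.Integer.Properties as Intₚ
open import Data.List
  using (List; []; _∷_; foldr; map; concatMap; tabulate; allFin; length; filter; upTo; cartesianProduct)
import Data.List as List
import Data.List.Properties as Listₚ
open import Data.List.Membership.Propositional using () renaming (_∈_ to _∈ˡ_; _∉_ to _∉ˡ_)
open import Data.List.Membership.Propositional.Properties
open import Data.List.Relation.Unary.All using ([]; _∷_)
import Data.List.Relation.Unary.All as All
open import Data.List.Relation.Unary.AllPairs using ([]; _∷_)
open import Data.List.Relation.Unary.Any using (here; there; index)
open import Data.List.Relation.Unary.Any.Properties using (lookup-index)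
open import Data.List.Relation.Unary.Unique.Propositional using (Unique)
import Data.List.Relation.Unary.Unique.Propositional.Properties as Uniqueₚ
open import Data.Nat using (ℕ; zero; suc; _+_; _∸_; _⊔_; _≤_; _<_; z≤n; s≤s; _<ᵇ_)
open import Data.Nat.Properties
open import Data.List.Membership.DecPropositional _≟_ using () renaming (_∈?_ to _∈ˡ?_)
open import Data.Product using (Σ; ∃; _×_; _,_; proj₁; proj₂)
open import Data.Sum using (_⊎_; inj₁; inj₂; [_,_]′)
import Data.Sum as Sum
open import Data.Unit using (⊤; tt)
open import Data.Vec using ([]; _∷_; _++_; lookup; replicate)
import Data.Vec as Vec
open import Data.Vec.Functional using (Vector) renaming (_∷_ to _◂_)
import Data.Vec.Properties as Vecₚ
open import Function using (_∘_; id; flip)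
open import Function.Bundles using (_⇔_; mk⇔; Equivalence)
open import Function.Definitions using (Injective)
import Function.Properties.Equivalence as ⇔
open import Level using (0ℓ)
open import Relation.Binary.PropositionalEquality renaming (sym to ≡-sym)
open import Relation.Nullary using (¬_; Dec; yes; no; does)

-- Predimension and disjoint unions

-- The obstacle is a vertex far from the position. Its component may be infinite, since neither
-- field of `Generic` bounds components, whereas `rich` realises only finite graphs, and closed sets
-- have no edges leaving them. So the copy is a finite graph with no exits, which need resemble the
-- original only for `r` rounds. A local game of `r` rounds from one vertex puts at most `r + 1`
-- vertices in play and goes no deeper than `r`; hence colours of depth `r` with multiplicities cut
-- off at `r + 1`. In `2r + 1`, the first `r + 1` rounds serve to walk to a vertex within distance
-- `r + 1`, leaving `r`. Beyond that distance two positions cannot interfere during `r` rounds,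
-- because a round shortens the distance by at most one, so strategies on both can be combined. Two
-- generic graphs are compared throughout, so the closure formula obtained at the end serves all of
-- them at once.

⊖-<-intro : ∀ a b c d → a + d < c + b → a Int.⊖ b Int.< c Int.⊖ d
⊖-<-intro a b c d lt = subst₂ Int._<_ (Intₚ.+-cancelˡ-⊖ d a b) (Intₚ.+-cancelˡ-⊖ b c d)
  (subst (λ z → (d + a) Int.⊖ z Int.< (b + c) Int.⊖ (b + d)) (+-comm b d)
    (Intₚ.⊖-monoˡ-< (b + d) (subst₂ _<_ (+-comm a d) (+-comm c b) lt)))

⊖-<-elim : ∀ a b c d → a Int.⊖ b Int.< c Int.⊖ d → a + d < c + b
⊖-<-elim a b c d lt = ≰⇒> λ le → Intₚ.<⇒≱ lt
  (subst₂ Int._≤_ (Intₚ.+-cancelˡ-⊖ b c d) (Intₚ.+-cancelˡ-⊖ d a b)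
    (subst (λ z → (b + c) Int.⊖ (b + d) Int.≤ (d + a) Int.⊖ z) (+-comm b d)
      (Intₚ.⊖-monoˡ-≤ (b + d) (subst₂ _≤_ (+-comm c b) (+-comm a d) le))))

-- Carrying each edge count to the other side moves comparisons of predimensions from the integers
-- to `ℕ`.
δ-<-intro : ∀ {m n} (G : FinGraph m) (H : FinGraph n) S T →
  ∣ S ∣ + edges H T < ∣ T ∣ + edges G S → δ G S Int.< δ H T
δ-<-intro G H S T lt = subst₂ Int._<_
  (≡-sym (Intₚ.m-n≡m⊖n (∣ S ∣) (edges G S))) (≡-sym (Intₚ.m-n≡m⊖n (∣ T ∣) (edges H T)))
  (⊖-<-intro (∣ S ∣) (edges G S) (∣ T ∣) (edges H T) lt)

δ-<-elim : ∀ {m n} (G : FinGraph m) (H : FinGraph n) S T →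
  δ G S Int.< δ H T → ∣ S ∣ + edges H T < ∣ T ∣ + edges G S
δ-<-elim G H S T lt = ⊖-<-elim (∣ S ∣) (edges G S) (∣ T ∣) (edges H T)
  (subst₂ Int._<_ (Intₚ.m-n≡m⊖n (∣ S ∣) (edges G S)) (Intₚ.m-n≡m⊖n (∣ T ∣) (edges H T)) lt)

0<δ-intro : ∀ {n} (G : FinGraph n) S → edges G S < ∣ S ∣ → Int.+ 0 Int.< δ G S
0<δ-intro G S lt = subst (Int.+ 0 Int.<_) (≡-sym (Intₚ.m-n≡m⊖n (∣ S ∣) (edges G S)))
  (⊖-<-intro 0 0 (∣ S ∣) (edges G S) (subst (edges G S <_) (≡-sym (+-identityʳ ∣ S ∣)) lt))

0<δ-elim : ∀ {n} (G : FinGraph n) S → Int.+ 0 Int.< δ G S → edges G S < ∣ S ∣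
0<δ-elim G S lt = subst (edges G S <_) (+-identityʳ ∣ S ∣)
  (⊖-<-elim 0 0 (∣ S ∣) (edges G S) (subst (Int.+ 0 Int.<_) (Intₚ.m-n≡m⊖n (∣ S ∣) (edges G S)) lt))

indicator : Bool → ℕ
indicator b = if b then 1 else 0

sum : ∀ {n} → (Fin n → ℕ) → ℕ
sum {zero}  f = 0
sum {suc n} f = f zero + sum (f ∘ suc)

sum-cong-≗ : ∀ {n} {f g : Fin n → ℕ} → f ≗ g → sum f ≡ sum g
sum-cong-≗ {zero}  f≗g = refl
sum-cong-≗ {suc n} f≗g = cong₂ _+_ (f≗g zero) (sum-cong-≗ (f≗g ∘ suc))

sum-++ : ∀ m {k} (f : Fin (m + k) → ℕ) → sum f ≡ sum (f ∘ (_↑ˡ k)) + sum (f ∘ (m ↑ʳ_))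
sum-++ zero    f = refl
sum-++ (suc m) f = trans (cong (f zero +_) (sum-++ m (f ∘ suc))) (≡-sym (+-assoc (f zero) _ _))

sum-zero : ∀ {n} (f : Fin n → ℕ) → (∀ i → f i ≡ 0) → sum f ≡ 0
sum-zero {zero}  f f≡0 = refl
sum-zero {suc n} f f≡0 rewrite f≡0 zero = sum-zero (f ∘ suc) (f≡0 ∘ suc)

≤-sum : ∀ {n} (f : Fin n → ℕ) i → f i ≤ sum f
≤-sum f zero    = m≤m+n _ _
≤-sum f (suc i) = ≤-trans (≤-sum (f ∘ suc) i) (m≤n+m _ (f zero))

+-≤-sum : ∀ {n} (f : Fin n → ℕ) {i j} → i ≢ j → f i + f j ≤ sum f
+-≤-sum f {zero}  {zero}  i≢j = ⊥-elim (i≢j refl)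
+-≤-sum f {zero}  {suc j} i≢j = +-monoʳ-≤ (f zero) (≤-sum (f ∘ suc) j)
+-≤-sum f {suc i} {zero}  i≢j =
  subst (_≤ sum f) (+-comm (f zero) (f (suc i))) (+-monoʳ-≤ (f zero) (≤-sum (f ∘ suc) i))
+-≤-sum f {suc i} {suc j} i≢j =
  ≤-trans (+-≤-sum (f ∘ suc) (i≢j ∘ cong suc)) (m≤n+m _ (f zero))

count-++ : ∀ {A : Set} (p : A → Bool) xs ys → count p (xs List.++ ys) ≡ count p xs + count p ys
count-++ p List.[]       ys = refl
count-++ p (x List.∷ xs) ys with p x
... | true  = cong suc (count-++ p xs ys)
... | false = count-++ p xs ys

count-map : ∀ {A B : Set} (p : B → Bool) (h : A → B) xs → count p (map h xs) ≡ count (p ∘ h) xs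
count-map p h List.[]       = refl
count-map p h (x List.∷ xs) with p (h x)
... | true  = cong suc (count-map p h xs)
... | false = count-map p h xs

count-tabulate : ∀ {A : Set} {n} (p : A → Bool) (h : Fin n → A) →
  count p (tabulate h) ≡ sum (indicator ∘ p ∘ h)
count-tabulate {n = zero}  p h = refl
count-tabulate {n = suc n} p h with p (h zero)
... | true  = cong suc (count-tabulate p (h ∘ suc))
... | false = count-tabulate p (h ∘ suc)

count-concatMap : ∀ {A B : Set} {n} (p : B → Bool) (h : A → List B) (f : Fin n → A) →
  count p (concatMap h (tabulate f)) ≡ sum (λ i → count p (h (f i)))
count-concatMap {n = zero}  p h f = refl
count-concatMap {n = suc n} p h f =
  trans (count-++ p (h (f zero)) _) (cong (count p (h (f zero)) +_) (count-concatMap p h (f ∘ suc)))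

count-pairs : ∀ {n} (p : Fin n × Fin n → Bool) →
  count p (pairs n) ≡ sum (λ i → sum (λ j → indicator (p (i , j))))
count-pairs {n} p = trans (count-concatMap p (λ i → map (i ,_) (allFin n)) id)
  (sum-cong-≗ λ i → trans (count-map p (i ,_) (allFin n)) (count-tabulate (p ∘ (i ,_)) id))

edges-sum : ∀ {n} (G : FinGraph n) S → edges G S ≡
  sum (λ i → sum (λ j → indicator ((toℕ i <ᵇ toℕ j) ∧ lookup S i ∧ lookup S j ∧ adj G i j)))
edges-sum {n} G S = count-pairs {n} _

degree-sum : ∀ {n} (G : FinGraph n) x → degree G x ≡ sum (indicator ∘ adj G x)
degree-sum G x = count-tabulate (adj G x) id

tailGraph : ∀ {n} → FinGraph (suc n) → FinGraph n
tailGraph G = record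
  { adj    = λ i j → adj G (suc i) (suc j)
  ; sym    = λ i j → FinGraph.sym G (suc i) (suc j)
  ; irrefl = λ i → irrefl G (suc i) }

edges-∷ : ∀ {n} (G : FinGraph (suc n)) s S → edges G (s ∷ S) ≡
  sum (λ j → indicator (s ∧ lookup S j ∧ adj G zero (suc j))) + edges (tailGraph G) S
edges-∷ G s S = trans (edges-sum G (s ∷ S))
  (cong (sum (λ j → indicator (s ∧ lookup S j ∧ adj G zero (suc j))) +_)
    (≡-sym (edges-sum (tailGraph G) S)))

edges-empty : ∀ {n} (G : FinGraph n) → edges G (replicate n outside) ≡ 0
edges-empty {zero}  G = refl
edges-empty {suc n} G = trans (edges-∷ G outside (replicate n outside))
  (cong₂ _+_ (sum-zero {n} _ (λ _ → refl)) (edges-empty (tailGraph G)))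

card-empty : ∀ n → ∣ replicate n outside ∣ ≡ 0
card-empty zero    = refl
card-empty (suc n) = card-empty n

card-++ : ∀ {m k} (S : Subset m) (T : Subset k) → ∣ S ++ T ∣ ≡ ∣ S ∣ + ∣ T ∣
card-++ []          T = refl
card-++ (true  ∷ S) T = cong suc (card-++ S T)
card-++ (false ∷ S) T = card-++ S T

⊎-adj : ∀ {m k} → FinGraph m → FinGraph k → Fin m ⊎ Fin k → Fin m ⊎ Fin k → Bool
⊎-adj F A (inj₁ i) (inj₁ j) = adj F i j
⊎-adj F A (inj₁ i) (inj₂ j) = false
⊎-adj F A (inj₂ i) (inj₁ j) = false
⊎-adj F A (inj₂ i) (inj₂ j) = adj A i j

infixr 5 _⊎ᴳ_
_⊎ᴳ_ : ∀ {m k} → FinGraph m → FinGraph k → FinGraph (m + k)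
_⊎ᴳ_ {m} {k} F A = record
  { adj    = λ x y → ⊎-adj F A (splitAt m x) (splitAt m y)
  ; sym    = λ x y → ⊎-sym (splitAt m x) (splitAt m y)
  ; irrefl = λ x → ⊎-irrefl (splitAt m x) }
  where
  ⊎-sym : ∀ u v → ⊎-adj F A u v ≡ ⊎-adj F A v u
  ⊎-sym (inj₁ i) (inj₁ j) = FinGraph.sym F i j
  ⊎-sym (inj₁ i) (inj₂ j) = refl
  ⊎-sym (inj₂ i) (inj₁ j) = refl
  ⊎-sym (inj₂ i) (inj₂ j) = FinGraph.sym A i j
  ⊎-irrefl : ∀ u → ⊎-adj F A u u ≡ false
  ⊎-irrefl (inj₁ i) = irrefl F i
  ⊎-irrefl (inj₂ i) = irrefl A i

module DisjointUnion {m k} (F : FinGraph m) (A : FinGraph k) where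

  adj-ll : ∀ i j → adj (F ⊎ᴳ A) (i ↑ˡ k) (j ↑ˡ k) ≡ adj F i j
  adj-ll i j = cong₂ (⊎-adj F A) (splitAt-↑ˡ m i k) (splitAt-↑ˡ m j k)

  adj-lr : ∀ i j → adj (F ⊎ᴳ A) (i ↑ˡ k) (m ↑ʳ j) ≡ false
  adj-lr i j = cong₂ (⊎-adj F A) (splitAt-↑ˡ m i k) (splitAt-↑ʳ m k j)

  adj-rl : ∀ i j → adj (F ⊎ᴳ A) (m ↑ʳ i) (j ↑ˡ k) ≡ false
  adj-rl i j = cong₂ (⊎-adj F A) (splitAt-↑ʳ m k i) (splitAt-↑ˡ m j k)

  adj-rr : ∀ i j → adj (F ⊎ᴳ A) (m ↑ʳ i) (m ↑ʳ j) ≡ adj A i j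
  adj-rr i j = cong₂ (⊎-adj F A) (splitAt-↑ʳ m k i) (splitAt-↑ʳ m k j)

  degree-l : ∀ i → degree (F ⊎ᴳ A) (i ↑ˡ k) ≡ degree F i
  degree-l i = trans (degree-sum (F ⊎ᴳ A) (i ↑ˡ k)) (trans (sum-++ m _) (trans
    (cong₂ _+_ (sum-cong-≗ λ j → cong indicator (adj-ll i j))
      (sum-zero (indicator ∘ adj (F ⊎ᴳ A) (i ↑ˡ k) ∘ (m ↑ʳ_)) λ j → cong indicator (adj-lr i j)))
    (trans (+-identityʳ _) (≡-sym (degree-sum F i)))))

  degree-r : ∀ i → degree (F ⊎ᴳ A) (m ↑ʳ i) ≡ degree A i
  degree-r i = trans (degree-sum (F ⊎ᴳ A) (m ↑ʳ i)) (trans (sum-++ m _) (trans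
    (cong₂ _+_
      (sum-zero (indicator ∘ adj (F ⊎ᴳ A) (m ↑ʳ i) ∘ (_↑ˡ k)) λ j → cong indicator (adj-rl i j))
      (sum-cong-≗ λ j → cong indicator (adj-rr i j)))
    (≡-sym (degree-sum A i))))

  edges-⊎ : ∀ (S : Subset m) (T : Subset k) → edges (F ⊎ᴳ A) (S ++ T) ≡ edges F S + edges A T
  edges-⊎ S T = trans (edges-sum (F ⊎ᴳ A) (S ++ T)) (trans (sum-++ m _) (cong₂ _+_
      (trans (sum-cong-≗ row-l) (≡-sym (edges-sum F S)))
      (trans (sum-cong-≗ row-r) (≡-sym (edges-sum A T)))))
    where
    b : Fin (m + k) → Fin (m + k) → Bool
    b x y = (toℕ x <ᵇ toℕ y) ∧ lookup (S ++ T) x ∧ lookup (S ++ T) y ∧ adj (F ⊎ᴳ A) x y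
    e : Fin (m + k) → Fin (m + k) → ℕ
    e x y = indicator (b x y)
    non-adj : ∀ x y → adj (F ⊎ᴳ A) x y ≡ false → e x y ≡ 0
    non-adj x y ≡h rewrite ≡h | ∧-zeroʳ (lookup (S ++ T) y) | ∧-zeroʳ (lookup (S ++ T) x)
                         | ∧-zeroʳ (toℕ x <ᵇ toℕ y) = refl
    <ᵇ-shift : ∀ m i j → (m + i <ᵇ m + j) ≡ (i <ᵇ j)
    <ᵇ-shift zero    i j = refl
    <ᵇ-shift (suc m) i j = <ᵇ-shift m i j
    row-l : ∀ i → sum (e (i ↑ˡ k)) ≡
      sum (λ j → indicator ((toℕ i <ᵇ toℕ j) ∧ lookup S i ∧ lookup S j ∧ adj F i j))
    row-l i = trans (sum-++ m _) (trans
      (cong₂ _+_ (sum-cong-≗ λ j → cong indicator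
          (cong₂ _∧_ (cong₂ _<ᵇ_ (toℕ-↑ˡ i k) (toℕ-↑ˡ j k))
            (cong₂ _∧_ (Vecₚ.lookup-++ˡ S T i) (cong₂ _∧_ (Vecₚ.lookup-++ˡ S T j) (adj-ll i j)))))
        (sum-zero _ λ j → non-adj (i ↑ˡ k) (m ↑ʳ j) (adj-lr i j)))
      (+-identityʳ _))
    row-r : ∀ i → sum (e (m ↑ʳ i)) ≡
      sum (λ j → indicator ((toℕ i <ᵇ toℕ j) ∧ lookup T i ∧ lookup T j ∧ adj A i j))
    row-r i = trans (sum-++ m _)
      (cong₂ _+_ (sum-zero _ λ j → non-adj (m ↑ʳ i) (j ↑ˡ k) (adj-rl i j))
        (sum-cong-≗ λ j → cong indicator
          (cong₂ _∧_ (trans (cong₂ _<ᵇ_ (toℕ-↑ʳ m i) (toℕ-↑ʳ m j)) (<ᵇ-shift m (toℕ i) (toℕ j)))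
            (cong₂ _∧_ (Vecₚ.lookup-++ʳ S T i) (cong₂ _∧_ (Vecₚ.lookup-++ʳ S T j) (adj-rr i j))))))

[]=-++ˡ⁻¹ : ∀ {m k} (S : Subset m) (T : Subset k) i → (i ↑ˡ k) ∈ (S ++ T) → i ∈ S
[]=-++ˡ⁻¹ S T i p = Vecₚ.lookup⇒[]= i S (trans (≡-sym (Vecₚ.lookup-++ˡ S T i)) (Vecₚ.[]=⇒lookup p))

[]=-++ʳ⁻¹ : ∀ {m k} (S : Subset m) (T : Subset k) i → (m ↑ʳ i) ∈ (S ++ T) → i ∈ T
[]=-++ʳ⁻¹ {m} S T i p = Vecₚ.lookup⇒[]= i T (trans (≡-sym (Vecₚ.lookup-++ʳ S T i)) (Vecₚ.[]=⇒lookup p))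

edges-<-card? : ∀ {n} (G : FinGraph n) → Kω G → ∀ S → edges G S < ∣ S ∣ ⊎ S ≡ replicate n outside
edges-<-card? G k S with Subₚ.nonempty? S
... | yes ne = inj₁ (0<δ-elim G S (k S ne))
... | no  ¬ne = inj₂ (Subₚ.Empty-unique ¬ne)

false≢true : false ≢ true
false≢true ()

-- A path starting in the range of `h` stays there, because the range contains all neighbours of its
-- vertices. The path condition of `KN` can thus be checked in each summand of a disjoint union.
path-restrict : ∀ {n l} (G : FinGraph n) (H : FinGraph l) (h : Fin l → Fin n) → Injective _≡_ _≡_ h →
  (∀ a b → adj G (h a) (h b) ≡ adj H a b) →
  (∀ a y → adj G (h a) y ≡ true → ∃ λ b → y ≡ h b) →
  ∀ N i → PathFrom G N (h i) → PathFrom H N i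
path-restrict {n} {l} G H h h-inj h-adj h-closed N i (p , inj , p0 , step) = q ,
  (λ {a} {b} q≡ → inj (trans (q-lift a) (trans (cong h q≡) (≡-sym (q-lift b))))) ,
  h-inj (trans (≡-sym (q-lift zero)) p0) ,
  λ a → trans (≡-sym (h-adj _ _))
    (trans (≡-sym (cong₂ (adj G) (q-lift (inject₁ a)) (q-lift (suc a)))) (step a))
  where
  stays : ∀ {L} (r : Fin (suc L) → Fin n) → (∀ a → adj G (r (inject₁ a)) (r (suc a)) ≡ true) →
    (∃ λ i → r zero ≡ h i) → ∀ a → ∃ λ i → r a ≡ h i
  stays r st r0 zero = r0
  stays {suc L} r st (i , r0) (suc a) = stays (r ∘ suc) (st ∘ suc)
    (h-closed i _ (trans (cong (λ z → adj G z _) (≡-sym r0)) (st zero))) a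
  q : Fin (suc (N + N)) → Fin l
  q a = proj₁ (stays p step (i , p0) a)
  q-lift : ∀ a → p a ≡ h (q a)
  q-lift a = proj₂ (stays p step (i , p0) a)

module _ {m k} (F : FinGraph m) (A : FinGraph k) where
  open DisjointUnion F A

  Kω-⊎ : Kω F → Kω A → Kω (F ⊎ᴳ A)
  Kω-⊎ kF kA B ne with Vec.splitAt m B
  ... | S , T , refl = 0<δ-intro (F ⊎ᴳ A) (S ++ T)
    (subst₂ _<_ (≡-sym (edges-⊎ S T)) (≡-sym (card-++ S T))
      (bound (edges-<-card? F kF S) (edges-<-card? A kA T)))
    where
    bound : edges F S < ∣ S ∣ ⊎ S ≡ _ → edges A T < ∣ T ∣ ⊎ T ≡ _ →
            edges F S + edges A T < ∣ S ∣ + ∣ T ∣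
    bound (inj₁ p)    (inj₁ q)    = +-mono-< p q
    bound (inj₁ p)    (inj₂ refl) rewrite edges-empty A | card-empty k = +-monoˡ-< 0 p
    bound (inj₂ refl) (inj₁ q)    rewrite edges-empty F | card-empty m = q
    bound (inj₂ refl) (inj₂ refl) = ⊥-elim (empty (proj₁ ne) (proj₂ ne))
      where
      empty : ∀ x → x ∉ replicate m outside ++ replicate k outside
      empty x x∈ with splitAt m x in ≡h
      ... | inj₁ i = Subₚ.∉⊥ ([]=-++ˡ⁻¹ (replicate m outside) _ i
                       (subst (_∈ _) (≡-sym (splitAt⁻¹-↑ˡ ≡h)) x∈))
      ... | inj₂ i = Subₚ.∉⊥ ([]=-++ʳ⁻¹ (replicate m outside) _ i
                       (subst (_∈ _) (≡-sym (splitAt⁻¹-↑ʳ {m} ≡h)) x∈))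

  -- A set above the base adds a non-empty part `S` of `F` and no edge towards `A`, so the
  -- predimension grows by that of `S`, which is positive.
  base-closed : Kω F → Closed (F ⊎ᴳ A) (base m k)
  base-closed kF D (base⊆D , x , x∈D , x∉base) with Vec.splitAt m D
  ... | S , T , refl = δ-<-intro (F ⊎ᴳ A) (F ⊎ᴳ A) (base m k) (S ++ T)
    (bound (trans (edges-⊎ (replicate m outside) Sub.⊤) (cong (_+ edges A Sub.⊤) (edges-empty F)))
           (trans (card-++ (replicate m outside) Sub.⊤) (cong (_+ ∣ Sub.⊤ {k} ∣) (card-empty m)))
           (trans (edges-⊎ S T) (cong (λ U → edges F S + edges A U) T≡⊤))
           (trans (card-++ S T) (cong (λ U → ∣ S ∣ + ∣ U ∣) T≡⊤))
           (edges-<-card? F kF S))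
    where
    T≡⊤ : T ≡ Sub.⊤
    T≡⊤ = Subₚ.⊆-antisym (Subₚ.⊆-max T) λ {i} _ → []=-++ʳ⁻¹ S T i
      (base⊆D (Vecₚ.lookup⇒[]= (m ↑ʳ i) (base m k)
        (trans (Vecₚ.lookup-++ʳ (replicate m outside) Sub.⊤ i) (Vecₚ.lookup-replicate i inside))))
    x∈S : S ≡ replicate m outside → ⊥
    x∈S refl = x∉base (subst (λ U → x ∈ (replicate m outside ++ U)) T≡⊤ x∈D)
    bound : ∀ {b c d e t u} → b ≡ 0 + t → c ≡ 0 + u → d ≡ edges F S + t → e ≡ ∣ S ∣ + u →
            edges F S < ∣ S ∣ ⊎ S ≡ _ → c + d < e + b
    bound _ _ _ _ (inj₂ p) = ⊥-elim (x∈S p)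
    bound {t = t} {u} refl refl refl refl (inj₁ p) = subst₂ _<_
      (trans (+-assoc (edges F S) t u) (trans (+-comm (edges F S) _)
        (trans (cong (_+ edges F S) (+-comm t u)) (trans (+-assoc u t _) (cong (u +_) (+-comm t _))))))
      (trans (+-assoc (∣ S ∣) t u) (trans (cong (∣ S ∣ +_) (+-comm t u)) (≡-sym (+-assoc (∣ S ∣) u t))))
      (+-monoˡ-< u (+-monoˡ-< t p))

  ⊎-elim : (P : Fin (m + k) → Set) → (∀ i → P (i ↑ˡ k)) → (∀ i → P (m ↑ʳ i)) → ∀ x → P x
  ⊎-elim P l r x with splitAt m x in ≡h
  ... | inj₁ i = subst P (splitAt⁻¹-↑ˡ ≡h) (l i)
  ... | inj₂ i = subst P (splitAt⁻¹-↑ʳ {m} ≡h) (r i)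

  path-l : ∀ N i → PathFrom (F ⊎ᴳ A) N (i ↑ˡ k) → PathFrom F N i
  path-l N i = path-restrict (F ⊎ᴳ A) F (_↑ˡ k) (↑ˡ-injective k _ _) adj-ll
    (λ a → ⊎-elim _ (λ b _ → b , refl) (λ b e → ⊥-elim (false≢true (trans (≡-sym (adj-lr a b)) e)))) N i

  path-r : ∀ N i → PathFrom (F ⊎ᴳ A) N (m ↑ʳ i) → PathFrom A N i
  path-r N i = path-restrict (F ⊎ᴳ A) A (m ↑ʳ_) (↑ʳ-injective m _ _) adj-rr
    (λ a → ⊎-elim _ (λ b e → ⊥-elim (false≢true (trans (≡-sym (adj-rl a b)) e))) (λ b _ → b , refl)) N i

  -- The disjoint union is the free amalgam over the empty set. Degrees and paths are those of one
  -- summand, so every defining condition is inherited.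
  K-⊎ : ∀ α → K α F → K α A → K α (F ⊎ᴳ A)
  K-⊎ omega         kF kA = Kω-⊎ kF kA
  K-⊎ (fin zero)    (kF , dF) (kA , dA) = Kω-⊎ kF kA ,
    ⊎-elim _ (λ i → subst (_≤ 3) (≡-sym (degree-l i)) (dF i))
             (λ i → subst (_≤ 3) (≡-sym (degree-r i)) (dA i))
  K-⊎ (fin (suc N)) (kF , pF) (kA , pA) = Kω-⊎ kF kA ,
    ⊎-elim _ (λ i d → pF i (subst (suc N + 2 ≤_) (degree-l i) d) ∘ path-l (suc N) i)
             (λ i d → pA i (subst (suc N + 2 ≤_) (degree-r i) d) ∘ path-r (suc N) i)

K⇒Kω : ∀ α {n} {G : FinGraph n} → K α G → Kω G
K⇒Kω omega         k = k
K⇒Kω (fin zero)    k = proj₁ k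
K⇒Kω (fin (suc N)) k = proj₁ k

card-⊤ : ∀ n → ∣ Sub.⊤ {n} ∣ ≡ n
card-⊤ zero    = refl
card-⊤ (suc n) = cong suc (card-⊤ n)

module _ {n} (G : FinGraph (suc n)) where

  private
    nbr : Fin n → ℕ
    nbr j = indicator (lookup (Sub.⊤ {n}) j ∧ adj G zero (suc j))

    nbr≡1 : ∀ {j} → adj G zero (suc j) ≡ true → nbr j ≡ 1
    nbr≡1 {j} e = cong indicator (cong₂ _∧_ (Vecₚ.lookup-replicate j true) e)

  edges-∷-neighbour : ∀ {i} → adj G zero (suc i) ≡ true →
    1 + edges (tailGraph G) Sub.⊤ ≤ edges G Sub.⊤
  edges-∷-neighbour {i} e = subst (1 + edges (tailGraph G) Sub.⊤ ≤_) (≡-sym (edges-∷ G true Sub.⊤))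
    (+-monoˡ-≤ (edges (tailGraph G) Sub.⊤) (subst (_≤ sum nbr) (nbr≡1 e) (≤-sum nbr i)))

  edges-∷-neighbours : ∀ {i j} → i ≢ j → adj G zero (suc i) ≡ true → adj G zero (suc j) ≡ true →
    2 + edges (tailGraph G) Sub.⊤ ≤ edges G Sub.⊤
  edges-∷-neighbours {i} {j} i≢j e f =
    subst (2 + edges (tailGraph G) Sub.⊤ ≤_) (≡-sym (edges-∷ G true Sub.⊤))
    (+-monoˡ-≤ (edges (tailGraph G) Sub.⊤)
      (subst (_≤ sum nbr) (cong₂ _+_ (nbr≡1 e) (nbr≡1 f)) (+-≤-sum nbr i≢j)))

-- The new vertex brings at least one edge, so it does not raise the predimension; the only proper
-- set above the base is the base itself, which is therefore not closed. This is what admits a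
-- quantifier over neighbours in `cex`.
neighbour-intrinsic : ∀ {k} (B : FinGraph (1 + k)) {i} → adj B zero (suc i) ≡ true → Intrinsic 1 k B
neighbour-intrinsic {k} B {i} e C base⊆C (C⊆⊤ , x , x∈⊤ , x∉C) closed = go C base⊆C x∉C closed
  where
  go : ∀ C → base 1 k ⊆ C → x ∉ C → Closed B C → ⊥
  go (c ∷ C) base⊆C x∉C closed = helper c x∉C closed
    (Subₚ.⊆-antisym (Subₚ.⊆-max C) λ i∈ → drop (base⊆C (Vec.there i∈)))
    where
    drop : ∀ {b i} {D : Subset k} → suc i ∈ (b ∷ D) → i ∈ D
    drop (Vec.there p) = p
    helper : ∀ c → x ∉ (c ∷ C) → Closed B (c ∷ C) → C ≡ Sub.⊤ → ⊥
    helper true  x∉ _ refl = x∉ Subₚ.∈⊤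
    helper false x∉ closed refl = <⇒≱
      (δ-<-elim B B (false ∷ Sub.⊤) Sub.⊤ (closed Sub.⊤ (Subₚ.⊆-max _ , x , x∈⊤ , x∉)))
      (subst (_≤ ∣ Sub.⊤ {k} ∣ + edges B Sub.⊤)
        (trans (+-suc (∣ Sub.⊤ {k} ∣) (edges (tailGraph B) Sub.⊤)) (cong (λ z → suc (∣ Sub.⊤ {k} ∣ + z))
          (≡-sym (trans (edges-∷ B false Sub.⊤)
            (cong (_+ edges (tailGraph B) Sub.⊤) (sum-zero {k} _ λ _ → refl))))))
        (+-monoʳ-≤ (∣ Sub.⊤ {k} ∣) (edges-∷-neighbour B e)))

◂-injective : ∀ {n} {w} {g : Fin n → ℕ} → Injective _≡_ _≡_ g → (∀ i → g i ≢ w) →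
  Injective _≡_ _≡_ (w ◂ g)
◂-injective inj w∉ {zero}  {zero}  _ = refl
◂-injective inj w∉ {zero}  {suc j} h = ⊥-elim (w∉ j (≡-sym h))
◂-injective inj w∉ {suc i} {zero}  h = ⊥-elim (w∉ i h)
◂-injective inj w∉ {suc i} {suc j} h = cong suc (inj h)

-- Adjoining `w` would add one vertex and at least one edge, so the predimension would not increase.
closed-no-exit : ∀ M {n} (g : Fin n → ℕ) → Injective _≡_ _≡_ g → ClosedIn M g →
  ∀ {w} i → edge M (g i) w ≡ true → ¬ (∀ j → g j ≢ w)
closed-no-exit M {n} g inj closed {w} i e w∉ = <⇒≱
  (δ-<-elim (induced M g) (induced M (w ◂ g)) Sub.⊤ Sub.⊤
    (closed (suc n) (w ◂ g) (◂-injective inj w∉) (λ j → suc j , refl) ≤-refl))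
  (subst (_≤ ∣ Sub.⊤ {n} ∣ + edges (induced M (w ◂ g)) Sub.⊤)
    (+-suc (∣ Sub.⊤ {n} ∣) _)
    (+-monoʳ-≤ (∣ Sub.⊤ {n} ∣) (edges-∷-neighbour (induced M (w ◂ g)) {i} (trans (esym M w (g i)) e))))

lookup-∷-injective : ∀ {x : ℕ} {xs : List ℕ} → x ∉ˡ xs → Injective _≡_ _≡_ (List.lookup xs) →
  Injective _≡_ _≡_ (List.lookup (x ∷ xs))
lookup-∷-injective x∉ inj {zero}  {zero}  _ = refl
lookup-∷-injective {xs = xs} x∉ inj {zero}  {suc j} h =
  ⊥-elim (x∉ (subst (_∈ˡ _) (≡-sym h) (∈-lookup {xs = xs} j)))
lookup-∷-injective {xs = xs} x∉ inj {suc i} {zero}  h =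
  ⊥-elim (x∉ (subst (_∈ˡ _) h (∈-lookup {xs = xs} i)))
lookup-∷-injective x∉ inj {suc i} {suc j} h = cong suc (inj h)

-- Walks and acyclicity

module _ (M : Graph) where

  data WalkAvoiding (v : ℕ) : ℕ → ℕ → Set where
    stop : ∀ {x} → x ≢ v → WalkAvoiding v x x
    step : ∀ {x y z} → x ≢ v → edge M x y ≡ true → WalkAvoiding v y z → WalkAvoiding v x z

  data SimplePath : ℕ → ℕ → List ℕ → Set where
    end  : ∀ {x} → SimplePath x x (x ∷ [])
    cons : ∀ {x y z xs} → edge M x y ≡ true → x ∉ˡ xs → SimplePath y z xs → SimplePath x z (x ∷ xs)

  -- Stated as the fact used later: deleting `v` separates its neighbours, so each heads a branch of
  -- its own. Walks may repeat vertices, which makes them easy to join and reverse.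
  Acyclic : Set
  Acyclic = ∀ {v w w′} → edge M v w ≡ true → edge M v w′ ≡ true → w ≢ w′ → ¬ WalkAvoiding v w w′

  path-suffix : ∀ {x y z xs} → SimplePath y z xs → x ∈ˡ xs →
    ∃ λ ys → SimplePath x z ys × (∀ {u} → u ∈ˡ ys → u ∈ˡ xs)
  path-suffix end            (here refl) = _ , end , id
  path-suffix p@(cons _ _ _) (here refl) = _ , p , id
  path-suffix (cons _ _ p)   (there x∈) with path-suffix p x∈
  ... | ys , q , ys⊆ = ys , q , there ∘ ys⊆

  walk⇒path : ∀ {v x z} → WalkAvoiding v x z → ∃ λ xs → SimplePath x z xs × v ∉ˡ xs
  walk⇒path (stop x≢v) = _ , end , λ { (here refl) → x≢v refl }
  walk⇒path {x = x} (step x≢v e w) with walk⇒path w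
  ... | xs , p , v∉ with x ∈ˡ? xs
  ...   | yes x∈ = let ys , q , ys⊆ = path-suffix p x∈ in ys , q , v∉ ∘ ys⊆
  ...   | no  x∉ = _ , cons e x∉ p , λ { (here refl) → x≢v refl ; (there v∈) → v∉ v∈ }

  path-head : ∀ {x z xs} → SimplePath x z xs → Σ (Fin (List.length xs)) λ i → List.lookup xs i ≡ x
  path-head end          = zero , refl
  path-head (cons _ _ _) = zero , refl

  path-last : ∀ {x z xs} → SimplePath x z xs → Σ (Fin (List.length xs)) λ i → List.lookup xs i ≡ z
  path-last end          = zero , refl
  path-last (cons _ _ p) = let i , h = path-last p in suc i , h

  path-injective : ∀ {x z xs} → SimplePath x z xs → Injective _≡_ _≡_ (List.lookup xs)
  path-injective end {zero} {zero} _ = refl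
  path-injective (cons _ x∉ p) = lookup-∷-injective x∉ (path-injective p)

  path-edges : ∀ {x z xs} → SimplePath x z xs →
    List.length xs ≤ suc (edges (induced M (List.lookup xs)) Sub.⊤)
  path-edges end = s≤s z≤n
  path-edges (cons {x = x} {xs = xs} e _ p) = s≤s (≤-trans (path-edges p)
    (edges-∷-neighbour (induced M (List.lookup (x ∷ xs))) {proj₁ (path-head p)}
      (trans (cong (edge M x) (proj₂ (path-head p))) e)))

  -- Shorten the walk to a simple path. Its `l` vertices carry at least `l - 1` edges, and `v` sends
  -- two more to the ends, so `l + 1` vertices carry at least `l + 1` edges.
  Kω⇒acyclic : (∀ n (a : Fin n → ℕ) → Injective _≡_ _≡_ a → Kω (induced M a)) → Acyclic
  Kω⇒acyclic age {v} e e′ w≢w′ walk with walk⇒path walk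
  ... | xs , p , v∉ = <⇒≱
    (subst (edges G Sub.⊤ <_) (card-⊤ _) (0<δ-elim G Sub.⊤
      (age (suc (List.length xs)) (List.lookup (v ∷ xs)) (lookup-∷-injective v∉ (path-injective p))
        Sub.⊤ (zero , Subₚ.∈⊤))))
    (≤-trans (s≤s (path-edges p))
      (edges-∷-neighbours G {proj₁ (path-head p)} {proj₁ (path-last p)}
        (λ h → w≢w′ (trans (≡-sym (proj₂ (path-head p)))
          (trans (cong (List.lookup xs) h) (proj₂ (path-last p)))))
        (trans (cong (edge M v) (proj₂ (path-head p))) e)
        (trans (cong (edge M v) (proj₂ (path-last p))) e′)))
    where
    G : FinGraph (suc (List.length xs))
    G = induced M (List.lookup (v ∷ xs))

generic-acyclic : ∀ {α M} → Generic α M → Acyclic M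
generic-acyclic {α} {M} gen = Kω⇒acyclic M λ n a inj → K⇒Kω α (Generic.age gen n a inj)

≢true⇒≡false : ∀ {b} → b ≢ true → b ≡ false
≢true⇒≡false {true}  b≢ = ⊥-elim (b≢ refl)
≢true⇒≡false {false} b≢ = refl

edge-sym : ∀ {M x y} → edge M x y ≡ true → edge M y x ≡ true
edge-sym {M} {x} {y} e = trans (esym M y x) e

module _ {M : Graph} where

  edge-≢ : ∀ {x y} → edge M x y ≡ true → x ≢ y
  edge-≢ {x} e refl = false≢true (trans (≡-sym (eirrefl M x)) e)

  walk-trans : ∀ {v x y z} → WalkAvoiding M v x y → WalkAvoiding M v y z → WalkAvoiding M v x z
  walk-trans (stop _)     w = w
  walk-trans (step n e u) w = step n e (walk-trans u w)

  walk-start : ∀ {v x y} → WalkAvoiding M v x y → x ≢ v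
  walk-start (stop n)     = n
  walk-start (step n _ _) = n

  walk-sym : ∀ {v x y} → WalkAvoiding M v x y → WalkAvoiding M v y x
  walk-sym (stop n)     = stop n
  walk-sym (step n e w) = walk-trans (walk-sym w) (step (walk-start w) (edge-sym {M} e) (stop n))

  -- If the walk visits `v`, cut it at the first visit; what remains still avoids `w`.
  walk-avoids-or-meets : ∀ {w x z} v → WalkAvoiding M w x z → WalkAvoiding M v x z ⊎ WalkAvoiding M w x v
  walk-avoids-or-meets {x = x} v u with x ≟ v
  walk-avoids-or-meets v u            | yes refl = inj₂ (stop (walk-start u))
  walk-avoids-or-meets v (stop _)     | no x≢v = inj₁ (stop x≢v)
  walk-avoids-or-meets v (step n e u) | no x≢v =
    Sum.map (step x≢v e) (step n e) (walk-avoids-or-meets v u)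

-- Finite lists of distinct vertices and lower bounds on cardinality

unique⇒lookup-injective : ∀ {xs : List ℕ} → Unique xs → Injective _≡_ _≡_ (List.lookup xs)
unique⇒lookup-injective {[]}     _ {()}
unique⇒lookup-injective {x ∷ xs} u@(_ ∷ us) =
  lookup-∷-injective (Uniqueₚ.Unique[x∷xs]⇒x∉xs u) (unique⇒lookup-injective us)

unique-fresh : ∀ {xs ys : List ℕ} → Unique xs → length ys < length xs → ∃ λ x → x ∈ˡ xs × x ∉ˡ ys
unique-fresh {xs} {ys} u lt with Finₚ.all? (λ i → List.lookup xs i ∈ˡ? ys)
... | no ¬all with i , i∉ ← Finₚ.¬∀⟶∃¬ _ _ (λ i → List.lookup xs i ∈ˡ? ys) ¬all = _ , ∈-lookup {xs = xs} i , i∉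
... | yes all∈ with i , j , i<j , h ← Finₚ.pigeonhole lt (index ∘ all∈) =
  ⊥-elim (Finₚ.<⇒≢ i<j (unique⇒lookup-injective u (trans (lookup-index (all∈ i))
    (trans (cong (List.lookup ys) h) (≡-sym (lookup-index (all∈ j)))))))

AtLeast : ℕ → (ℕ → Set) → Set
AtLeast j P = Σ (List ℕ) λ xs → length xs ≡ j × Unique xs × (∀ {x} → x ∈ˡ xs → P x)

-- Partners are chosen one by one; they are distinct because a partner determines its element. The
-- last component of `go` remembers the origin of each partner for this purpose.
atLeast-transfer : ∀ {j} {P Q : ℕ → Set} (R : ℕ → ℕ → Set) →
  (∀ x → P x → ∃ λ y → R x y × Q y) → (∀ {x x′ y} → R x y → R x′ y → x ≡ x′) →
  AtLeast j P → AtLeast j Q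
atLeast-transfer {P = P} {Q} R total inj (xs , len , uniq , sat) =
  let ys , len′ , uniq′ , sat′ , _ = go xs uniq sat in ys , trans len′ len , uniq′ , sat′
  where
  go : ∀ xs → Unique xs → (∀ {x} → x ∈ˡ xs → P x) → Σ (List ℕ) λ ys → length ys ≡ length xs ×
    Unique ys × (∀ {y} → y ∈ˡ ys → Q y) × (∀ {y} → y ∈ˡ ys → ∃ λ x → x ∈ˡ xs × R x y)
  go [] _ _ = [] , refl , [] , (λ ()) , λ ()
  go (x ∷ xs) u@(_ ∷ us) p with total x (p (here refl)) | go xs us (p ∘ there)
  ... | y , Rxy , Qy | ys , len , uniq , sat , from =
    y ∷ ys , cong suc len ,
    All.tabulate (λ { z∈ refl → let x′ , x′∈ , Rx′y = from z∈ in
      Uniqueₚ.Unique[x∷xs]⇒x∉xs u (subst (_∈ˡ xs) (inj Rx′y Rxy) x′∈) }) ∷ uniq ,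
    (λ { (here refl) → Qy ; (there z∈) → sat z∈ }) ,
    λ { (here refl) → x , here refl , Rxy ; (there z∈) → let x′ , x′∈ , r = from z∈ in x′ , there x′∈ , r }

atLeast-⊆ : ∀ {j} {P Q : ℕ → Set} → (∀ {x} → P x → Q x) → AtLeast j P → AtLeast j Q
atLeast-⊆ P⊆Q (xs , len , uniq , sat) = xs , len , uniq , P⊆Q ∘ sat

-- `age` and `diag` need injective tuples, while assignments and lists of vertices may repeat
-- values.
dedup : ∀ {n} (ρ : Fin n → ℕ) → Σ ℕ λ k → k ≤ n × Σ (Fin k → Fin n) λ s →
  Injective _≡_ _≡_ (ρ ∘ s) × (∀ j → ∃ λ i → ρ (s i) ≡ ρ j)
dedup {zero}  ρ = zero , z≤n , (λ ()) , (λ {}) , λ ()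
dedup {suc n} ρ with dedup (ρ ∘ suc)
... | k , k≤n , s , inj , cover with Finₚ.any? (λ i → ρ (suc (s i)) ≟ ρ zero)
...   | yes old = k , m≤n⇒m≤1+n k≤n , suc ∘ s , inj , λ { zero → old ; (suc j) → cover j }
...   | no ¬old = suc k , s≤s k≤n , zero ◂ (suc ∘ s) , inj′ ,
  λ { zero → zero , refl ; (suc j) → let i , h = cover j in suc i , h }
  where
  inj′ : Injective _≡_ _≡_ (ρ ∘ (zero ◂ (suc ∘ s)))
  inj′ {zero}  {zero}  _ = refl
  inj′ {zero}  {suc j} h = ⊥-elim (¬old (j , ≡-sym h))
  inj′ {suc i} {zero}  h = ⊥-elim (¬old (i , h))
  inj′ {suc i} {suc j} h = cong suc (inj h)

-- The local game

-- A position is a relation, not a pair of tuples, so that positions can be extended, restricted and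
-- merged without reindexing.
Rel : Set₁
Rel = ℕ → ℕ → Set

_⊆ʳ_ : Rel → Rel → Set
P ⊆ʳ Q = ∀ {x y} → P x y → Q x y

Ext : Rel → ℕ → ℕ → Rel
Ext P y y′ a b = (a ≡ y × b ≡ y′) ⊎ P a b

graph : ∀ {n} → (Fin n → ℕ) → (Fin n → ℕ) → Rel
graph a a′ x x′ = ∃ λ i → a i ≡ x × a′ i ≡ x′

record Atomic (M M′ : Graph) (P : Rel) : Set where
  field
    to   : ∀ {x x′ y y′} → P x x′ → P y y′ → x ≡ y → x′ ≡ y′
    from : ∀ {x x′ y y′} → P x x′ → P y y′ → x′ ≡ y′ → x ≡ y
    edges≡ : ∀ {x x′ y y′} → P x x′ → P y y′ → edge M x y ≡ edge M′ x′ y′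

-- Duplicator survives r rounds of the local game from position P, in which Spoiler
-- may only play neighbours of vertices already in play.
E : Graph → Graph → ℕ → Rel → Set
E M M′ zero    P = Atomic M M′ P
E M M′ (suc r) P = Atomic M M′ P ×
  (∀ {x x′} → P x x′ → ∀ y → edge M x y ≡ true → ∃ λ y′ → E M M′ r (Ext P y y′)) ×
  (∀ {x x′} → P x x′ → ∀ y′ → edge M′ x′ y′ ≡ true → ∃ λ y → E M M′ r (Ext P y y′))

module _ {M M′ : Graph} where

  E-atomic : ∀ r {P} → E M M′ r P → Atomic M M′ P
  E-atomic zero    h = h
  E-atomic (suc r) h = proj₁ h

  atomic-⊆ : ∀ {P Q} → Q ⊆ʳ P → Atomic M M′ P → Atomic M M′ Q
  atomic-⊆ Q⊆P h = record
    { to     = λ p q → to (Q⊆P p) (Q⊆P q)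
    ; from   = λ p q → from (Q⊆P p) (Q⊆P q)
    ; edges≡ = λ p q → edges≡ (Q⊆P p) (Q⊆P q) }
    where open Atomic h

  E-⊆ : ∀ r {P Q} → Q ⊆ʳ P → E M M′ r P → E M M′ r Q
  E-⊆ zero    Q⊆P h = atomic-⊆ Q⊆P h
  E-⊆ (suc r) Q⊆P (at , forth , back) = atomic-⊆ Q⊆P at ,
    (λ p y e → let y′ , h = forth (Q⊆P p) y e in y′ , E-⊆ r (Sum.map₂ Q⊆P) h) ,
    (λ p y′ e → let y , h = back (Q⊆P p) y′ e in y , E-⊆ r (Sum.map₂ Q⊆P) h)

  E-pred : ∀ r {P} → E M M′ (suc r) P → E M M′ r P
  E-pred zero    h = proj₁ h
  E-pred (suc r) (at , forth , back) = at ,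
    (λ p y e → let y′ , h = forth p y e in y′ , E-pred r h) ,
    (λ p y′ e → let y , h = back p y′ e in y , E-pred r h)

  E-drop : ∀ d {r P} → E M M′ (d + r) P → E M M′ r P
  E-drop zero    h = h
  E-drop (suc d) h = E-drop d (E-pred _ h)

atomic-sym : ∀ {M M′ P} → Atomic M M′ P → Atomic M′ M (flip P)
atomic-sym h = record { to = from ; from = to ; edges≡ = λ p q → ≡-sym (edges≡ p q) }
  where open Atomic h

swap-ext : ∀ {P y y′} → Ext (flip P) y′ y ⊆ʳ flip (Ext P y y′)
swap-ext = Sum.map₁ λ (p , q) → q , p

E-sym : ∀ {M M′} r {P} → E M M′ r P → E M′ M r (flip P)
E-sym zero    h = atomic-sym h
E-sym (suc r) {P} (at , forth , back) = atomic-sym at ,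
  (λ p y e → let y′ , h = back p y e in y′ , E-⊆ r (swap-ext {P}) (E-sym r h)) ,
  (λ p y′ e → let y , h = forth p y′ e in y , E-⊆ r (swap-ext {P}) (E-sym r h))

-- Bounded distance and merging of distant positions

Near : Graph → ℕ → ℕ → ℕ → Set
Near M zero    x z = x ≡ z
Near M (suc d) x z = Near M d x z ⊎ ∃ λ u → edge M x u ≡ true × Near M d u z

module _ {M : Graph} where

  near-refl : ∀ d {x} → Near M d x x
  near-refl zero    = refl
  near-refl (suc d) = inj₁ (near-refl d)

  near-snoc : ∀ d {x y z} → Near M d x y → edge M y z ≡ true → Near M (suc d) x z
  near-snoc zero    refl               e = inj₂ (_ , e , refl)
  near-snoc (suc d) (inj₁ n)           e = inj₁ (near-snoc d n e)
  near-snoc (suc d) (inj₂ (u , e′ , n)) e = inj₂ (u , e′ , near-snoc d n e)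

Far : Graph → Graph → ℕ → Rel → Rel → Set
Far M M′ d P Q = ∀ {x x′ z z′} → P x x′ → Q z z′ → ¬ Near M d x z × ¬ Near M′ d x′ z′

module _ {M M′ : Graph} where

  far-atomic : ∀ {P Q R} d → Atomic M M′ P → Atomic M M′ Q → Far M M′ (suc d) P Q →
    (∀ {x y} → R x y → P x y ⊎ Q x y) → Atomic M M′ R
  far-atomic {P} {Q} {R} d hP hQ far cover = record
    { to     = λ r s → to′ (cover r) (cover s)
    ; from   = λ r s → from′ (cover r) (cover s)
    ; edges≡ = λ r s → edges′ (cover r) (cover s) }
    where
    module P = Atomic hP
    module Q = Atomic hQ
    PQ = λ x y → P x y ⊎ Q x y
    apart : ∀ {x x′ z z′} → P x x′ → Q z z′ → edge M x z ≡ false × edge M′ x′ z′ ≡ false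
    apart p q =
      (≢true⇒≡false λ e → proj₁ (far p q) (inj₂ (_ , e , near-refl d))) ,
      (≢true⇒≡false λ e → proj₂ (far p q) (inj₂ (_ , e , near-refl d)))
    to′ : ∀ {x x′ y y′} → PQ x x′ → PQ y y′ → x ≡ y → x′ ≡ y′
    to′ (inj₁ p) (inj₁ q) = P.to p q
    to′ (inj₂ p) (inj₂ q) = Q.to p q
    to′ (inj₁ p) (inj₂ q) refl = ⊥-elim (proj₁ (far p q) (near-refl (suc d)))
    to′ (inj₂ p) (inj₁ q) refl = ⊥-elim (proj₁ (far q p) (near-refl (suc d)))
    from′ : ∀ {x x′ y y′} → PQ x x′ → PQ y y′ → x′ ≡ y′ → x ≡ y
    from′ (inj₁ p) (inj₁ q) = P.from p q
    from′ (inj₂ p) (inj₂ q) = Q.from p q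
    from′ (inj₁ p) (inj₂ q) refl = ⊥-elim (proj₂ (far p q) (near-refl (suc d)))
    from′ (inj₂ p) (inj₁ q) refl = ⊥-elim (proj₂ (far q p) (near-refl (suc d)))
    edges′ : ∀ {x x′ y y′} → PQ x x′ → PQ y y′ → edge M x y ≡ edge M′ x′ y′
    edges′ (inj₁ p) (inj₁ q) = P.edges≡ p q
    edges′ (inj₂ p) (inj₂ q) = Q.edges≡ p q
    edges′ (inj₁ p) (inj₂ q) = let a , b = apart p q in trans a (≡-sym b)
    edges′ (inj₂ p) (inj₁ q) = let a , b = apart q p in
      trans (trans (esym M _ _) a) (≡-sym (trans (esym M′ _ _) b))

mutual
  -- Each move is answered in the half that it is adjacent to. Distance and remaining rounds both
  -- drop by at most one per move, so after the last round the halves are still disjoint and not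
  -- adjacent.
  E-∪ : ∀ {M M′} r {P Q R} → E M M′ r P → E M M′ r Q → Far M M′ (suc r) P Q →
    (∀ {x y} → R x y → P x y ⊎ Q x y) → E M M′ r R
  E-∪ zero    hP hQ far cover = far-atomic zero hP hQ far cover
  E-∪ (suc r) {P} {Q} {R} hP hQ far cover =
    far-atomic (suc r) (E-atomic (suc r) hP) (E-atomic (suc r) hQ) far cover ,
    E-∪-forth r hP hQ far cover ,
    λ p y′ e → let y , h = E-∪-forth r (E-sym (suc r) hP) (E-sym (suc r) hQ)
                             (λ q q′ → let a , b = far q q′ in b , a) cover p y′ e
               in y , E-⊆ r (swap-ext {flip R}) (E-sym r h)

  E-∪-forth : ∀ {M M′} r {P Q R} → E M M′ (suc r) P → E M M′ (suc r) Q → Far M M′ (suc (suc r)) P Q →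
    (∀ {x y} → R x y → P x y ⊎ Q x y) →
    ∀ {x x′} → R x x′ → ∀ y → edge M x y ≡ true → ∃ λ y′ → E M M′ r (Ext R y y′)
  E-∪-forth {M} {M′} r {P} {Q} hP hQ far cover p y e with cover p
  -- The answer is adjacent to `x′` because the new position is atomic, so the distance bound
  -- survives in `M′` too.
  ... | inj₁ p∈ = let y′ , h = proj₁ (proj₂ hP) p∈ y e
                      e′ = trans (≡-sym (Atomic.edges≡ (E-atomic r h) (inj₂ p∈) (inj₁ (refl , refl)))) e
    in y′ , E-∪ r h (E-pred r hQ)
      (λ { (inj₁ (refl , refl)) q → (λ n → proj₁ (far p∈ q) (inj₂ (_ , e , n)))
                                  , (λ n → proj₂ (far p∈ q) (inj₂ (_ , e′ , n)))
         ; (inj₂ p′) q → let a , b = far p′ q in (a ∘ inj₁) , (b ∘ inj₁) })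
      (λ { (inj₁ h) → inj₁ (inj₁ h) ; (inj₂ h) → Sum.map₁ inj₂ (cover h) })
  ... | inj₂ q∈ = let y′ , h = proj₁ (proj₂ hQ) q∈ y e
                      e′ = trans (≡-sym (Atomic.edges≡ (E-atomic r h) (inj₂ q∈) (inj₁ (refl , refl)))) e
    in y′ , E-∪ r (E-pred r hP) h
      (λ { q (inj₁ (refl , refl)) → (λ n → proj₁ (far q q∈) (near-snoc (suc r) n (edge-sym {M} e)))
                                  , (λ n → proj₂ (far q q∈) (near-snoc (suc r) n (edge-sym {M′} e′)))
         ; q (inj₂ p′) → let a , b = far q p′ in (a ∘ inj₁) , (b ∘ inj₁) })
      (λ { (inj₁ h) → inj₂ (inj₁ h) ; (inj₂ h) → Sum.map₂ inj₂ (cover h) })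

-- At most `d` moves follow a path to `a`; the intermediate vertices are then dropped from the
-- position.
near-extend : ∀ {M M′} d {r P x x′ a} → E M M′ (d + r) P → P x x′ → Near M d x a →
  ∃ λ a′ → E M M′ r (Ext P a a′)
near-extend zero    {r} h p refl = _ , E-⊆ r (λ { (inj₁ (refl , refl)) → p ; (inj₂ q) → q }) h
near-extend (suc d) h p (inj₁ n) = near-extend d (E-pred _ h) p n
near-extend (suc d) {r} (_ , forth , _) p (inj₂ (u , e , n)) =
  let u′ , h   = forth p u e
      a′ , h′ = near-extend d h (inj₁ (refl , refl)) n
  in a′ , E-⊆ r (Sum.map₂ inj₂) h′

-- Colours of branches and their finite approximations

map-≡-lookup : ∀ {A B : Set} {f g : A → B} xs → map f xs ≡ map g xs → ∀ {x} → x ∈ˡ xs → f x ≡ g x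
map-≡-lookup (x ∷ xs) h (here refl) = Listₚ.∷-injectiveˡ h
map-≡-lookup (x ∷ xs) h (there x∈)  = map-≡-lookup xs (Listₚ.∷-injectiveʳ h) x∈

does-≡ : {P Q : Set} (p? : Dec P) (q? : Dec Q) → (P → Q) → (Q → P) → does p? ≡ does q?
does-≡ (yes p) (yes q) to from = refl
does-≡ (yes p) (no ¬q) to from = ⊥-elim (¬q (to p))
does-≡ (no ¬p) (yes q) to from = ⊥-elim (¬p (from q))
does-≡ (no ¬p) (no ¬q) to from = refl

does-≡⁻¹ : {P Q : Set} (p? : Dec P) (q? : Dec Q) → does p? ≡ does q? → P → Q
does-≡⁻¹ p?      (yes q) h p = q
does-≡⁻¹ (no ¬p) (no ¬q) h p = ⊥-elim (¬p p)

boolLists : ℕ → List (List Bool)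
boolLists zero    = [] ∷ []
boolLists (suc n) = map (true ∷_) (boolLists n) List.++ map (false ∷_) (boolLists n)

∈-boolLists : ∀ bs → bs ∈ˡ boolLists (length bs)
∈-boolLists []           = here refl
∈-boolLists (true  ∷ bs) = ∈-++⁺ˡ (∈-map⁺ _ (∈-boolLists bs))
∈-boolLists (false ∷ bs) = ∈-++⁺ʳ (map (true ∷_) (boolLists (length bs))) (∈-map⁺ _ (∈-boolLists bs))

module Colours (em : ExcludedMiddle 0ℓ) (m : ℕ) where

  Colour : Set
  Colour = List Bool

  mutual
    -- A colour of depth `suc k` is the vector of answers to the questions in `table k`, so there
    -- are finitely many colours of each depth.
    colours : ℕ → List Colour
    colours zero    = boolLists 0
    colours (suc k) = boolLists (length (table k))

    table : ℕ → List (Colour × ℕ)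
    table k = cartesianProduct (colours k) (upTo (suc m))

  mutual
    -- The isomorphism type, to depth k and with multiplicities cut off at m, of the part of
    -- the forest M hanging from v away from its parent p; a root is its own parent.
    colour : Graph → ℕ → ℕ → ℕ → Colour
    colour M zero    v p = []
    colour M (suc k) v p = map (λ (c , j) → does (em {AtLeast j (Child M k v p c)})) (table k)

    Child : Graph → ℕ → ℕ → ℕ → Colour → ℕ → Set
    Child M k v p c w = edge M v w ≡ true × w ≢ p × colour M k w v ≡ c

  colour-∈ : ∀ M k v p → colour M k v p ∈ˡ colours k
  colour-∈ M zero    v p = here refl
  colour-∈ M (suc k) v p = subst (λ l → colour M (suc k) v p ∈ˡ boolLists l)
    (Listₚ.length-map _ (table k)) (∈-boolLists (colour M (suc k) v p))

  colour-children : ∀ {M M′} k {v p v′ p′ c j} → colour M (suc k) v p ≡ colour M′ (suc k) v′ p′ →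
    (c , j) ∈ˡ table k → AtLeast j (Child M k v p c) → AtLeast j (Child M′ k v′ p′ c)
  colour-children k h cj∈ = does-≡⁻¹ em em (map-≡-lookup (table k) h cj∈)

  -- Colours are taken in `M`, not in `F`: `F` need only contain, at each vertex reached, as many
  -- children of each colour as the table can ask for.
  Good : Graph → (ℕ → Set) → ℕ → ℕ → ℕ → Set
  Good M F zero    v p = ⊤
  Good M F (suc k) v p =
    (∀ {w} → F w → edge M v w ≡ true → w ≢ p → Good M F k w v) ×
    (∀ {c j} → (c , j) ∈ˡ table k → AtLeast j (Child M k v p c) →
      AtLeast j (λ w → F w × Child M k v p c w))

  -- As nothing leaves the range of `g`, the children of `g i` correspond to the children of `f i`
  -- inside `F`. By `Good` these already give every positive answer in the table; conversely,
  -- children inside `F` are children in `M`.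
  good-colour : ∀ {M M′ F n} (f g : Fin n → ℕ) → Injective _≡_ _≡_ f → Injective _≡_ _≡_ g →
    (∀ i j → edge M′ (g i) (g j) ≡ edge M (f i) (f j)) →
    (∀ i {w} → edge M′ (g i) w ≡ true → ∃ λ j → w ≡ g j) →
    (∀ {x} → F x → ∃ λ i → f i ≡ x) → (∀ i → F (f i)) →
    ∀ k i p → Good M F k (f i) (f p) → colour M k (f i) (f p) ≡ colour M′ k (g i) (g p)
  good-colour f g f-inj g-inj iso closed F⇒f f⇒F zero i p good = refl
  good-colour {M} {M′} {F} f g f-inj g-inj iso closed F⇒f f⇒F (suc k) i p (hered , full) =
    Listₚ.map-cong-local (All.tabulate λ cj∈ → does-≡ em em
      (λ al → atLeast-transfer (λ x y → ∃ λ a → f a ≡ x × g a ≡ y) push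
        (λ { (a , refl , refl) (b , refl , h) → cong f (g-inj (≡-sym h)) }) (full cj∈ al))
      (atLeast-transfer (λ y x → ∃ λ a → f a ≡ x × g a ≡ y) pull
        (λ { (a , refl , refl) (b , h , refl) → cong g (f-inj (≡-sym h)) })))
    where
    child-colour : ∀ a → edge M (f i) (f a) ≡ true → f a ≢ f p →
      colour M k (f a) (f i) ≡ colour M′ k (g a) (g i)
    child-colour a e a≢p =
      good-colour f g f-inj g-inj iso closed F⇒f f⇒F k a i (hered (f⇒F a) e a≢p)
    push : ∀ {c} x → F x × Child M k (f i) (f p) c x →
      ∃ λ y → (∃ λ a → f a ≡ x × g a ≡ y) × Child M′ k (g i) (g p) c y
    push x (Fx , e , x≢p , col) with F⇒f Fx
    ... | a , refl = g a , (a , refl , refl) , trans (iso i a) e ,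
      (λ h → x≢p (cong f (g-inj h))) , trans (≡-sym (child-colour a e x≢p)) col
    pull : ∀ {c} y → Child M′ k (g i) (g p) c y →
      ∃ λ x → (∃ λ a → f a ≡ x × g a ≡ y) × Child M k (f i) (f p) c x
    pull y (e , y≢p , col) with closed i e
    ... | a , refl = f a , (a , refl , refl) , e′ , a≢p , trans (child-colour a e′ a≢p) col
      where
      e′ : edge M (f i) (f a) ≡ true
      e′ = trans (≡-sym (iso i a)) e
      a≢p : f a ≢ f p
      a≢p h = y≢p (cong g (f-inj h))

  -- Only the entries that hold contribute witnesses, at most `j` each, so finitely many children
  -- suffice even at a vertex of infinite degree.
  select : ∀ (Q : Colour → ℕ → Set) tab → Σ (List ℕ) λ W → (∀ {w} → w ∈ˡ W → ∃ λ c → Q c w) ×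
    (∀ {c j} → (c , j) ∈ˡ tab → AtLeast j (Q c) → AtLeast j (λ w → w ∈ˡ W × Q c w))
  select Q [] = [] , (λ ()) , λ ()
  select Q ((c , j) ∷ tab) with em {AtLeast j (Q c)} | select Q tab
  ... | no ¬al | W , sound , complete = W , sound ,
    λ { (here refl) al → ⊥-elim (¬al al) ; (there cj∈) al → complete cj∈ al }
  ... | yes (xs , len , uniq , sat) | W , sound , complete = xs List.++ W ,
    (λ w∈ → [ (λ w∈xs → c , sat w∈xs) , sound ]′ (∈-++⁻ xs w∈)) ,
    λ { (here refl) _ → xs , len , uniq , λ x∈ → ∈-++⁺ˡ x∈ , sat x∈
      ; (there cj∈) al → atLeast-⊆ (λ (w∈ , q) → ∈-++⁺ʳ xs w∈ , q) (complete cj∈ al) }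

  module _ {M : Graph} (acyclic : Acyclic M) where

    -- A walk from `u` that met `v` would join two neighbours of `w` without passing through `w`.
    branch-⊆ : ∀ {v w u x} → edge M w v ≡ true → edge M w u ≡ true → u ≢ v →
      WalkAvoiding M w u x → WalkAvoiding M v w x
    branch-⊆ {v} {w} {u} wv wu u≢v walk with walk-avoids-or-meets v walk
    ... | inj₁ walk′ = step (edge-≢ {M} wv) wu walk′
    ... | inj₂ back  = ⊥-elim (acyclic wu wv u≢v back)

    -- Goodness of `w` concerns only its branch away from `v`, so trees chosen in other branches may
    -- be added.
    good-local : ∀ {F F′ : ℕ → Set} k {v w} → edge M w v ≡ true → (∀ {x} → F x → F′ x) →
      (∀ {x} → F′ x → WalkAvoiding M v w x → F x) → Good M F k w v → Good M F′ k w v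
    good-local zero wv F⊆ ⊆F good = tt
    good-local (suc k) {v} {w} wv F⊆ ⊆F (hered , full) =
      (λ {u} F′u e u≢v → good-local k (edge-sym {M} e) F⊆
        (λ F′x walk → ⊆F F′x (branch-⊆ wv e u≢v walk))
        (hered (⊆F F′u (step (edge-≢ {M} wv) e (stop u≢v))) e u≢v)) ,
      λ cj∈ al → atLeast-⊆ (λ (Fx , q) → F⊆ Fx , q) (full cj∈ al)

    -- Confinement to the branch away from `p` keeps the trees chosen for different children apart.
    -- It is conditional on an edge to `p` because the root is its own parent.
    approximate : ∀ k v p → Σ (List ℕ) λ xs → v ∈ˡ xs ×
      (edge M v p ≡ true → ∀ {x} → x ∈ˡ xs → WalkAvoiding M p v x) × Good M (_∈ˡ xs) k v p
    approximate zero v p = v ∷ [] , here refl , (λ { e (here refl) → stop (edge-≢ {M} e) }) , tt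
    approximate (suc k) v p with select (Child M k v p) (table k)
    ... | W , sound , complete = xs , here refl , confined , hered ,
      λ cj∈ al → atLeast-⊆ (λ (w∈ , q) → root∈ w∈ , q) (complete cj∈ al)
      where
      branch : ℕ → List ℕ
      branch w = proj₁ (approximate k w v)
      xs : List ℕ
      xs = v ∷ concatMap branch W
      branch∈ : ∀ {w x} → w ∈ˡ W → x ∈ˡ branch w → x ∈ˡ xs
      branch∈ w∈ x∈ = there (∈-concat⁺′ x∈ (∈-map⁺ branch w∈))
      root∈ : ∀ {w} → w ∈ˡ W → w ∈ˡ xs
      root∈ {w} w∈ = branch∈ w∈ (proj₁ (proj₂ (approximate k w v)))
      branch-walk : ∀ {w x} → w ∈ˡ W → x ∈ˡ branch w → WalkAvoiding M v w x
      branch-walk {w} w∈ x∈ = proj₁ (proj₂ (proj₂ (approximate k w v)))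
        (edge-sym {M} (proj₁ (proj₂ (sound w∈)))) x∈
      xs⁻ : ∀ {x} → x ∈ˡ xs → x ≡ v ⊎ ∃ λ w → w ∈ˡ W × x ∈ˡ branch w
      xs⁻ (here h) = inj₁ h
      xs⁻ (there x∈) with ∈-concat⁻′ (map branch W) x∈
      ... | ys , x∈ys , ys∈ with ∈-map⁻ branch ys∈
      ...   | w , w∈ , refl = inj₂ (w , w∈ , x∈ys)
      confined : edge M v p ≡ true → ∀ {x} → x ∈ˡ xs → WalkAvoiding M p v x
      confined vp x∈ with xs⁻ x∈
      ... | inj₁ refl = stop (edge-≢ {M} vp)
      ... | inj₂ (w , w∈ , x∈w) = let _ , vw , w≢p , _ = sound w∈ in
        branch-⊆ vp vw w≢p (branch-walk w∈ x∈w)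
      -- If `x` lay in the tree of another chosen child, the two children would be joined by a walk
      -- avoiding `v`.
      in-branch : ∀ {w x} → edge M v w ≡ true → x ∈ˡ xs → WalkAvoiding M v w x →
        w ∈ˡ W × x ∈ˡ branch w
      in-branch {w} vw x∈ walk with xs⁻ x∈
      ... | inj₁ refl = ⊥-elim (walk-start (walk-sym walk) refl)
      ... | inj₂ (w′ , w′∈ , x∈w′) with w ≟ w′
      ...   | yes refl = w′∈ , x∈w′
      ...   | no w≢w′  = ⊥-elim (acyclic vw (proj₁ (proj₂ (sound w′∈))) w≢w′
                           (walk-trans walk (walk-sym (branch-walk w′∈ x∈w′))))
      hered : ∀ {w} → w ∈ˡ xs → edge M v w ≡ true → w ≢ p → Good M (_∈ˡ xs) k w v
      hered {w} w∈ vw w≢p with in-branch vw w∈ (stop (edge-≢ {M} vw ∘ ≡-sym))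
      ... | w∈W , _ = good-local k (edge-sym {M} vw) (branch∈ w∈W)
        (λ x∈ walk → proj₂ (in-branch vw x∈ walk)) (proj₂ (proj₂ (proj₂ (approximate k w v))))

-- Positions of the game started from single vertices are connected, so a vertex new to the
-- position is joined to exactly one old vertex.  Spoiler's new vertex is answered by one of
-- the same colour, which is free because the old children of that colour correspond.
module Matching (em : ExcludedMiddle 0ℓ) (m : ℕ) where
  open Colours em m

  -- `small` keeps every count of siblings within the cut-off `m`. `depth i` is the depth to which
  -- colours at `i` agree: it drops by one from parent to child and never falls below the number of
  -- rounds left.
  record Match (M M′ : Graph) (r : ℕ) {n} (a a′ : Fin n → ℕ) : Set where
    field
      small : n + r ≤ m
      inj   : Injective _≡_ _≡_ a
      inj′  : Injective _≡_ _≡_ a′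
      iso   : ∀ i j → edge M (a i) (a j) ≡ edge M′ (a′ i) (a′ j)
      conn  : ∀ {y} → (∀ i → a i ≢ y) → ∀ i j → WalkAvoiding M y (a i) (a j)
      conn′ : ∀ {y} → (∀ i → a′ i ≢ y) → ∀ i j → WalkAvoiding M′ y (a′ i) (a′ j)
      depth  : Fin n → ℕ
      parent : Fin n → Fin n
      depth≥ : ∀ i → r ≤ depth i
      col    : ∀ i → colour M (depth i) (a i) (a (parent i)) ≡ colour M′ (depth i) (a′ i) (a′ (parent i))
      child-col : ∀ i w {k} → depth i ≡ suc k → edge M (a i) (a w) ≡ true → w ≢ parent i →
        colour M k (a w) (a i) ≡ colour M′ k (a′ w) (a′ i)

  match-sym : ∀ {M M′ r n} {a a′ : Fin n → ℕ} → Match M M′ r a a′ → Match M′ M r a′ a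
  match-sym h = record
    { small = small ; inj = inj′ ; inj′ = inj ; iso = λ i j → ≡-sym (iso i j)
    ; conn = conn′ ; conn′ = conn ; depth = depth ; parent = parent ; depth≥ = depth≥
    ; col = λ i → ≡-sym (col i)
    ; child-col = λ i w d e w≢ → ≡-sym (child-col i w d (trans (iso i w) e) w≢) }
    where open Match h

  match-pred : ∀ {M M′ r n} {a a′ : Fin n → ℕ} → Match M M′ (suc r) a a′ → Match M M′ r a a′
  match-pred {r = r} {n} h = record
    { small = ≤-trans (+-monoʳ-≤ n (n≤1+n r)) small
    ; inj = inj ; inj′ = inj′ ; iso = iso ; conn = conn ; conn′ = conn′ ; depth = depth
    ; parent = parent ; depth≥ = λ i → ≤-trans (n≤1+n r) (depth≥ i) ; col = col ; child-col = child-col }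
    where open Match h

  match-atomic : ∀ {M M′ r n} {a a′ : Fin n → ℕ} → Match M M′ r a a′ → Atomic M M′ (graph a a′)
  match-atomic {a = a} {a′} h = record
    { to     = λ { (i , refl , refl) (j , refl , refl) e → cong a′ (inj e) }
    ; from   = λ { (i , refl , refl) (j , refl , refl) e → cong a (inj′ e) }
    ; edges≡ = λ { (i , refl , refl) (j , refl , refl) → iso i j } }
    where open Match h

  sole-neighbour : ∀ {M n y} {a : Fin n → ℕ} → Acyclic M → Injective _≡_ _≡_ a →
    (∀ {y} → (∀ i → a i ≢ y) → ∀ i j → WalkAvoiding M y (a i) (a j)) →
    (∀ i → a i ≢ y) → ∀ {i j} → edge M y (a i) ≡ true → edge M y (a j) ≡ true → j ≡ i
  sole-neighbour acyclic inj conn fresh {i} {j} e f with j Fin.≟ i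
  ... | yes h = h
  ... | no j≢i = ⊥-elim (acyclic e f (λ h → j≢i (≡-sym (inj h))) (conn fresh i j))

  conn-◂ : ∀ {M n y} {a : Fin n → ℕ} {i} → edge M (a i) y ≡ true →
    (∀ {z} → (∀ i → a i ≢ z) → ∀ i j → WalkAvoiding M z (a i) (a j)) →
    ∀ {z} → (∀ i → (y ◂ a) i ≢ z) → ∀ j l → WalkAvoiding M z ((y ◂ a) j) ((y ◂ a) l)
  conn-◂ {M} {i = i} e conn fresh zero    zero    = stop (fresh zero)
  conn-◂ {M} {i = i} e conn fresh zero    (suc l) =
    step (fresh zero) (edge-sym {M} e) (conn (fresh ∘ suc) i l)
  conn-◂ {M} {i = i} e conn fresh (suc j) zero    =
    walk-trans (conn (fresh ∘ suc) j i) (step (fresh (suc i)) e (stop (fresh zero)))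
  conn-◂ {M} {i = i} e conn fresh (suc j) (suc l) = conn (fresh ∘ suc) j l

  module _ {M M′} (acyclic : Acyclic M) (acyclic′ : Acyclic M′)
           {r n} {a a′ : Fin n → ℕ} (h : Match M M′ (suc r) a a′) where
    open Match h

    match-◂ : ∀ {y y′ i k} → (∀ j → a j ≢ y) → (∀ j → a′ j ≢ y′) →
      edge M (a i) y ≡ true → edge M′ (a′ i) y′ ≡ true → depth i ≡ suc k →
      colour M k y (a i) ≡ colour M′ k y′ (a′ i) → Match M M′ r (y ◂ a) (y′ ◂ a′)
    match-◂ {y} {y′} {i} {k} fresh fresh′ e e′ d≡ col≡ = record
      { small = subst (_≤ m) (+-suc n r) small
      ; inj = ◂-injective inj fresh ; inj′ = ◂-injective inj′ fresh′
      ; iso = iso◂ ; conn = conn-◂ {M} e conn ; conn′ = conn-◂ {M′} e′ conn′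
      ; depth = k ◂ depth
      ; parent = suc i ◂ (suc ∘ parent)
      ; depth≥ = λ { zero → ≤-pred (subst (suc r ≤_) d≡ (depth≥ i)) ; (suc j) → ≤-trans (n≤1+n r) (depth≥ j) }
      ; col = λ { zero → col≡ ; (suc j) → col j }
      ; child-col = child-col◂ }
      where
      sole : ∀ {j} → edge M y (a j) ≡ true → j ≡ i
      sole f = sole-neighbour acyclic inj conn fresh (edge-sym {M} e) f
      sole′ : ∀ {j} → edge M′ y′ (a′ j) ≡ true → j ≡ i
      sole′ f = sole-neighbour acyclic′ inj′ conn′ fresh′ (edge-sym {M′} e′) f
      new-row : ∀ j → edge M y (a j) ≡ edge M′ y′ (a′ j)
      new-row j with j Fin.≟ i
      ... | yes refl = trans (edge-sym {M} e) (≡-sym (edge-sym {M′} e′))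
      ... | no j≢i   = trans (≢true⇒≡false (j≢i ∘ sole)) (≡-sym (≢true⇒≡false (j≢i ∘ sole′)))
      iso◂ : ∀ j l → edge M ((y ◂ a) j) ((y ◂ a) l) ≡ edge M′ ((y′ ◂ a′) j) ((y′ ◂ a′) l)
      iso◂ zero    zero    = trans (eirrefl M y) (≡-sym (eirrefl M′ y′))
      iso◂ zero    (suc l) = new-row l
      iso◂ (suc j) zero    = trans (esym M _ y) (trans (new-row j) (esym M′ y′ _))
      iso◂ (suc j) (suc l) = iso j l
      child-col◂ : ∀ j w {k′} → (k ◂ depth) j ≡ suc k′ → edge M ((y ◂ a) j) ((y ◂ a) w) ≡ true →
        w ≢ (suc i ◂ (suc ∘ parent)) j →
        colour M k′ ((y ◂ a) w) ((y ◂ a) j) ≡ colour M′ k′ ((y′ ◂ a′) w) ((y′ ◂ a′) j)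
      child-col◂ zero    zero    _ f _  = ⊥-elim (edge-≢ {M} f refl)
      child-col◂ zero    (suc w) _ f w≢ = ⊥-elim (w≢ (cong suc (sole f)))
      child-col◂ (suc j) zero    d f _  with sole (edge-sym {M} f)
      ... | refl with refl ← trans (≡-sym d) d≡ = col≡
      child-col◂ (suc j) (suc w) d f w≢ = child-col j w d f (w≢ ∘ cong suc)

    match-forth : ∀ i {y} → edge M (a i) y ≡ true →
      (∃ λ j → a j ≡ y) ⊎ ∃ λ y′ → Match M M′ r (y ◂ a) (y′ ◂ a′)
    match-forth i {y} e with Finₚ.any? (λ j → a j ≟ y)
    ... | yes old = inj₁ old
    ... | no ¬old with depth i in d≡ | depth≥ i | col i
    -- `found` has one more element than there are old children of this colour, so some element is
    -- not a partner of any of them.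
    ...   | suc k | s≤s r≤k | col≡ = inj₂ (answer (unique-fresh (proj₁ (proj₂ (proj₂ found)))
              (≤-reflexive (≡-sym (trans (proj₁ (proj₂ found)) (cong suc (≡-sym (Listₚ.length-map a′ same))))))))
      where
      c : Colour
      c = colour M k y (a i)
      Sibling : Fin n → Set
      Sibling w = edge M (a i) (a w) ≡ true × w ≢ parent i × colour M k (a w) (a i) ≡ c
      same : List (Fin n)
      same = filter (λ w → em {Sibling w}) (allFin n)
      siblings : List ℕ
      siblings = map a same
      -- At most `n` old children together with `y` are counted, and `small` gives `n + 1 ≤ m`, so
      -- the table contains this count.
      same-small : suc (length same) ≤ m
      same-small = ≤-trans (s≤s (≤-trans (Listₚ.length-filter _ (allFin n)) (≤-reflexive (Listₚ.length-tabulate id))))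
        (≤-trans (≤-trans (m≤m+n (suc n) r) (≤-reflexive (≡-sym (+-suc n r)))) small)
      y∉ : y ∉ˡ siblings
      y∉ y∈ = let w , _ , h = ∈-map⁻ a y∈ in ¬old (w , ≡-sym h)
      found : AtLeast (suc (length same)) (Child M′ k (a′ i) (a′ (parent i)) c)
      found = colour-children k col≡
        (∈-cartesianProduct⁺ (colour-∈ M k y (a i)) (∈-upTo⁺ (s≤s same-small)))
        (y ∷ siblings , cong suc (Listₚ.length-map a same) ,
         All.tabulate (λ { z∈ refl → y∉ z∈ }) ∷ Uniqueₚ.map⁺ inj (Uniqueₚ.filter⁺ _ (Uniqueₚ.allFin⁺ n)) ,
         λ { (here refl) → e , (λ h → ¬old (parent i , ≡-sym h)) , refl
           ; (there z∈) → sib (∈-map⁻ a z∈) })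
        where
        sib : ∀ {z} → (∃ λ w → w ∈ˡ same × z ≡ a w) → Child M k (a i) (a (parent i)) c z
        sib (w , w∈ , refl) with ∈-filter⁻ (λ w → em {Sibling w}) {xs = allFin n} w∈
        ... | _ , f , w≢p , q = f , w≢p ∘ inj , q
      answer : (∃ λ y′ → y′ ∈ˡ proj₁ found × y′ ∉ˡ map a′ same) → ∃ λ y′ → Match M M′ r (y ◂ a) (y′ ◂ a′)
      answer (y′ , y′∈ , y′∉) with proj₂ (proj₂ (proj₂ found)) y′∈
      ... | e′ , y′≢p , q = y′ , match-◂ (λ j h → ¬old (j , h)) fresh′ e e′ d≡ (≡-sym q)
        where
        -- If `y′` were an old vertex `a′ j`, then `a j` would be a child of `a i` of colour `c`,
        -- which puts `j` in `same`.
        fresh′ : ∀ j → a′ j ≢ y′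
        fresh′ j refl = y′∉ (∈-map⁺ a′ (∈-filter⁺ (λ w → em {Sibling w}) (∈-allFin j)
          (f , j≢p , trans (child-col i j d≡ f j≢p) q)))
          where
          f : edge M (a i) (a j) ≡ true
          f = trans (iso i j) e′
          j≢p : j ≢ parent i
          j≢p refl = y′≢p refl

  match⇒E : ∀ {M M′} → Acyclic M → Acyclic M′ → ∀ r {n} {a a′ : Fin n → ℕ} →
    Match M M′ r a a′ → E M M′ r (graph a a′)
  match⇒E-forth : ∀ {M M′} → Acyclic M → Acyclic M′ → ∀ r {n} {a a′ : Fin n → ℕ} →
    Match M M′ (suc r) a a′ → ∀ {x x′} → graph a a′ x x′ → ∀ y → edge M x y ≡ true →
    ∃ λ y′ → E M M′ r (Ext (graph a a′) y y′)
  match⇒E ac ac′ zero    h = match-atomic h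
  match⇒E ac ac′ (suc r) {a = a} {a′} h = match-atomic h , match⇒E-forth ac ac′ r h ,
    λ { (i , p , q) y′ e → let y , g = match⇒E-forth ac′ ac r (match-sym h) (i , q , p) y′ e in
      y , E-⊆ r (λ { (inj₁ (p , q)) → inj₁ (q , p) ; (inj₂ (i , p , q)) → inj₂ (i , q , p) }) (E-sym r g) }
  match⇒E-forth ac ac′ r {a = a} {a′} h (i , refl , refl) y e with match-forth ac ac′ h i e
  ... | inj₁ (j , refl) = a′ j , E-⊆ r (λ { (inj₁ (refl , refl)) → j , refl , refl ; (inj₂ g) → g })
                            (match⇒E ac ac′ r (match-pred h))
  ... | inj₂ (y′ , h′) = y′ , E-⊆ r (λ { (inj₁ (refl , refl)) → zero , refl , refl
                                       ; (inj₂ (j , p , q)) → suc j , p , q }) (match⇒E ac ac′ r h′)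

  -- `suc r` bounds the vertices in play after `r` rounds, the starting vertex included.
  colour⇒match : ∀ {M M′ r v v′} → suc r ≤ m → colour M r v v ≡ colour M′ r v′ v′ →
    Match M M′ r {1} (λ _ → v) (λ _ → v′)
  colour⇒match {M} {M′} {r} {v} {v′} r<m col≡ = record
    { small = r<m ; inj = λ { {zero} {zero} _ → refl } ; inj′ = λ { {zero} {zero} _ → refl }
    ; iso = λ _ _ → trans (eirrefl M v) (≡-sym (eirrefl M′ v′))
    ; conn = λ fresh _ _ → stop (fresh zero) ; conn′ = λ fresh _ _ → stop (fresh zero)
    ; depth = λ _ → r ; parent = id ; depth≥ = λ _ → ≤-refl ; col = λ _ → col≡
    ; child-col = λ { zero zero _ e _ → ⊥-elim (edge-≢ {M} e refl) } }

-- Copies of finite graphs as unions of components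

module _ {α : Alpha} {M : Graph} (gen : Generic α M) where
  open Generic gen

  empty-closed : ClosedIn {0} M (λ ())
  empty-closed p c inj _ 0<p = δ-<-intro (induced {0} M (λ ())) (induced M c) Sub.⊤ Sub.⊤
    (subst (edges (induced M c) Sub.⊤ <_) (≡-sym (+-identityʳ _))
      (0<δ-elim (induced M c) Sub.⊤ (K⇒Kω α (age p c inj) Sub.⊤ (Fin.fromℕ< 0<p , Subₚ.∈⊤))))

  module _ {m} (F : FinGraph m) (kF : K α F) where

    -- `closed` concerns the whole range of `g`, old part included, so that a further copy can be
    -- placed above it.
    record Copy {k} (g : Fin (m + k) → ℕ) : Set where
      field
        inj    : Injective _≡_ _≡_ g
        closed : ClosedIn M g
        iso    : ∀ i j → edge M (g (i ↑ˡ k)) (g (j ↑ˡ k)) ≡ adj F i j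
        no-exit : ∀ i {w} → edge M (g (i ↑ˡ k)) w ≡ true → ∃ λ j → w ≡ g (j ↑ˡ k)

    place : ∀ {k} (a : Fin k → ℕ) → Injective _≡_ _≡_ a → ClosedIn M a →
      Σ (Fin (m + k) → ℕ) λ g → Copy g × (∀ i → g (m ↑ʳ i) ≡ a i)
    place {k} a a-inj a-closed
      with g , g-inj , ext , g-iso , g-closed ←
        rich m k (F ⊎ᴳ induced M a) a a-inj (λ i j → ≡-sym (DisjointUnion.adj-rr F (induced M a) i j))
          a-closed (K-⊎ F (induced M a) α kF (age k a a-inj))
          (base-closed F (induced M a) (K⇒Kω α kF))
      = g , record
        { inj = g-inj ; closed = g-closed
        ; iso = λ i j → trans (g-iso (i ↑ˡ k) (j ↑ˡ k)) (adj-ll i j)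
        ; no-exit = no-exit } , ext
      where
      open DisjointUnion F (induced M a)
      no-exit : ∀ i {w} → edge M (g (i ↑ˡ k)) w ≡ true → ∃ λ j → w ≡ g (j ↑ˡ k)
      no-exit i {w} e with Finₚ.any? (λ x → g x ≟ w)
      ... | no ¬in = ⊥-elim (closed-no-exit M g g-inj g-closed (i ↑ˡ k) e (λ j h → ¬in (j , h)))
      ... | yes (x , refl) = ⊎-elim F (induced M a)
        (λ x → adj (F ⊎ᴳ induced M a) (i ↑ˡ k) x ≡ true → ∃ λ j → g x ≡ g (j ↑ˡ k))
        (λ j _ → j , refl)
        (λ j f → ⊥-elim (false≢true (trans (≡-sym (adj-lr i j)) f)))
        x (trans (≡-sym (g-iso (i ↑ˡ k) x)) e)

    -- If a copy meets b, the copies found above it miss b, since they are disjoint from it.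
    place-avoiding : ∀ bad {k} (a : Fin k → ℕ) → Injective _≡_ _≡_ a → ClosedIn M a →
      Σ ℕ λ k′ → Σ (Fin (m + k′) → ℕ) λ g → Copy g ×
        (∀ i → ∃ λ j → g (m ↑ʳ j) ≡ a i) × (∀ {b} → b ∈ˡ bad → ∀ i → g (i ↑ˡ k′) ≢ b)
    place-avoiding [] {k} a a-inj a-closed = let g , copy , ext = place a a-inj a-closed in
      k , g , copy , (λ i → i , ext i) , λ ()
    place-avoiding (b ∷ bad) a a-inj a-closed with place-avoiding bad a a-inj a-closed
    ... | k , g , copy , ext , miss with Finₚ.any? (λ i → g (i ↑ˡ k) ≟ b)
    ...   | no ¬hit = k , g , copy , ext ,
      λ { (here refl) i h → ¬hit (i , h) ; (there b∈) → miss b∈ }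
    ...   | yes (i , hit) with place-avoiding bad g (Copy.inj copy) (Copy.closed copy)
    ...     | k′ , g′ , copy′ , ext′ , miss′ = k′ , g′ , copy′ ,
      (λ j → let j₁ , h₁ = ext j ; j₂ , h₂ = ext′ (m ↑ʳ j₁) in j₂ , trans h₂ h₁) ,
      λ { (here refl) i′ h → let j , h₂ = ext′ (i ↑ˡ k) in
            l≢r i′ j (Copy.inj copy′ (trans h (trans (≡-sym hit) (≡-sym h₂))))
        ; (there b∈) → miss′ b∈ }
      where
      l≢r : ∀ i j → i ↑ˡ k′ ≢ m ↑ʳ j
      l≢r i j h with () ← trans (≡-sym (splitAt-↑ˡ m i k′)) (trans (cong (splitAt m) h) (splitAt-↑ʳ m k′ j))

    -- No edge leaves the copy, so a vertex outside it is far from it at every distance `d`.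
    copy-far : ∀ {k} {g : Fin (m + k) → ℕ} → Copy g → ∀ d {x} i → Near M d x (g (i ↑ˡ k)) →
      ∃ λ j → x ≡ g (j ↑ˡ k)
    copy-far copy zero    i refl = i , refl
    copy-far copy (suc d) i (inj₁ n) = copy-far copy d i n
    copy-far copy (suc d) i (inj₂ (u , e , n)) with copy-far copy d i n
    ... | j , refl = Copy.no-exit copy j (edge-sym {M} e)

-- A vertex near the position is reached by playing towards it.  For a far one a, a finite
-- piece of M around a is copied to a union of components of M′ that misses the position.
module _ (em : ExcludedMiddle 0ℓ) {α : Alpha} {M M′ : Graph} (gen : Generic α M) (gen′ : Generic α M′) where

  isolated-twin : ∀ r a bad → Σ ℕ λ a′ → E M M′ r (graph {1} (λ _ → a) (λ _ → a′)) ×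
    (∀ d {b} → b ∈ˡ bad → ¬ Near M′ d b a′)
  isolated-twin r a bad
    with xs , a∈ , _ , good ← Colours.approximate em (suc r) (generic-acyclic gen) r a a
    with n , _ , s , f-inj , cover ← dedup (List.lookup xs)
    -- Starting over the empty set suffices: once the copy misses `bad`, it shares no component with
    -- it.
    with k , g , copy , _ , miss ← place-avoiding gen′ (induced M (List.lookup xs ∘ s))
           (Generic.age gen n _ f-inj) bad {0} (λ ()) (λ {}) (empty-closed gen′)
    with i , fi≡ ← cover (index a∈)
    = g (i ↑ˡ k) ,
      match⇒E (generic-acyclic gen) (generic-acyclic gen′) r (colour⇒match ≤-refl colour≡) ,
      λ d b∈ n → let j , h = copy-far gen′ _ (Generic.age gen _ _ f-inj) copy d i n in miss b∈ j (≡-sym h)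
    where
    open Matching em (suc r)
    open Colours em (suc r)
    f : Fin n → ℕ
    f = List.lookup xs ∘ s
    fi≡a : f i ≡ a
    fi≡a = trans fi≡ (≡-sym (lookup-index a∈))
    colour≡ : colour M r a a ≡ colour M′ r (g (i ↑ˡ k)) (g (i ↑ˡ k))
    colour≡ = subst (λ z → colour M r z z ≡ colour M′ r (g (i ↑ˡ k)) (g (i ↑ˡ k))) fi≡a
      (good-colour f (g ∘ (_↑ˡ k)) f-inj (λ h → Finₚ.↑ˡ-injective k _ _ (Copy.inj copy h))
        (Copy.iso copy) (Copy.no-exit copy)
        (λ x∈ → let j , h = cover (index x∈) in j , trans h (≡-sym (lookup-index x∈)))
        (λ j → ∈-lookup {xs = xs} (s j)) r i i
        (subst (λ z → Good M (_∈ˡ xs) r z z) (≡-sym fi≡a) good))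

  extend : ∀ r {n} {ρ ρ′ : Fin n → ℕ} → E M M′ (suc r + r) (graph ρ ρ′) → ∀ a →
    ∃ λ a′ → E M M′ r (graph (a ◂ ρ) (a′ ◂ ρ′))
  extend r {n} {ρ} {ρ′} h a with em {∃ λ i → Near M (suc r) (ρ i) a}
  ... | yes (i , near) = let a′ , h′ = near-extend (suc r) h (i , refl , refl) near in
    a′ , E-⊆ r (λ { (zero , refl , refl) → inj₁ (refl , refl) ; (suc j , p , q) → inj₂ (j , p , q) }) h′
  ... | no ¬near = let a′ , h′ , apart = isolated-twin r a (tabulate ρ′) in
    a′ , E-∪ r (E-drop (suc r) h) h′
      (λ { (j , refl , refl) (_ , refl , refl) →
             (λ near → ¬near (j , near)) , apart (suc r) (∈-tabulate⁺ j) })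
      (λ { (zero , refl , refl) → inj₂ (zero , refl , refl) ; (suc j , p , q) → inj₁ (j , p , q) })

-- Closure formulas describing the local game

-- A listed graph matches a given one only pointwise, so membership in `K` must be transported.
K-cong : ∀ α {n} {G H : FinGraph n} → (∀ i j → adj H i j ≡ adj G i j) → K α G → K α H
K-cong α {n} {G} {H} h = go α
  where
  edges-cong : ∀ S → edges H S ≡ edges G S
  edges-cong S = trans (edges-sum H S) (trans (sum-cong-≗ λ i → sum-cong-≗ λ j →
    cong (λ b → indicator ((toℕ i <ᵇ toℕ j) ∧ lookup S i ∧ lookup S j ∧ b)) (h i j))
    (≡-sym (edges-sum G S)))
  degree-cong : ∀ x → degree H x ≡ degree G x
  degree-cong x = trans (degree-sum H x) (trans (sum-cong-≗ λ j → cong indicator (h x j))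
    (≡-sym (degree-sum G x)))
  Kω-cong : Kω G → Kω H
  Kω-cong k B ne = 0<δ-intro H B (subst (_< Sub.∣ B ∣) (≡-sym (edges-cong B)) (0<δ-elim G B (k B ne)))
  go : ∀ α → K α G → K α H
  go omega         k       = Kω-cong k
  go (fin zero)    (k , d) = Kω-cong k , λ x → subst (_≤ 3) (≡-sym (degree-cong x)) (d x)
  go (fin (suc N)) (k , p) = Kω-cong k , λ x deg (q , inj , q0 , st) →
    p x (subst (suc N + 2 ≤_) (degree-cong x) deg) (q , inj , q0 , λ i → trans (≡-sym (h _ _)) (st i))

functions : ∀ {A : Set} k → List A → List (Fin k → A)
functions zero    xs = (λ ()) ∷ []
functions (suc k) xs = concatMap (λ x → map (x ◂_) (functions k xs)) xs

-- The relation `R` stands in for equality of functions, so the rows of an adjacency matrix may be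
-- matched entry by entry.
functions-complete : ∀ {A : Set} k (xs : List A) (R : Fin k → A → Set) →
  (∀ i → ∃ λ x → x ∈ˡ xs × R i x) → ∃ λ f → f ∈ˡ functions k xs × (∀ i → R i (f i))
functions-complete zero    xs R total = _ , here refl , λ ()
functions-complete (suc k) xs R total with total zero | functions-complete k xs (R ∘ suc) (total ∘ suc)
... | x , x∈ , Rx | f , f∈ , Rf = x ◂ f ,
  ∈-concat⁺′ (∈-map⁺ (x ◂_) f∈) (∈-map⁺ (λ x → map (x ◂_) (functions k xs)) x∈) ,
  λ { zero → Rx ; (suc i) → Rf i }

sat-rename⁺ : ∀ {M k n} {s : Fin k → Fin n} {ρ : Vector ℕ n} {σ : Vector ℕ k} →
  (∀ i → ρ (s i) ≡ σ i) → ∀ φ → Sat M σ φ → Sat M ρ (rename s φ)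
sat-rename⁻ : ∀ {M k n} {s : Fin k → Fin n} {ρ : Vector ℕ n} {σ : Vector ℕ k} →
  (∀ i → ρ (s i) ≡ σ i) → ∀ φ → Sat M ρ (rename s φ) → Sat M σ φ

sat-rename⁺ h tt        x = x
sat-rename⁺ h (eq i j)  x = trans (h i) (trans x (≡-sym (h j)))
sat-rename⁺ {M} h (rel i j) x = trans (cong₂ (edge M) (h i) (h j)) x
sat-rename⁺ h (not φ)   x = x ∘ sat-rename⁻ h φ
sat-rename⁺ h (φ and ψ) (x , y) = sat-rename⁺ h φ x , sat-rename⁺ h ψ y
sat-rename⁺ h (φ or ψ)  x = Sum.map (sat-rename⁺ h φ) (sat-rename⁺ h ψ) x
sat-rename⁺ h (φ imp ψ) x = sat-rename⁺ h ψ ∘ x ∘ sat-rename⁻ h φ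
sat-rename⁺ h (ex φ) (a , x) = a , sat-rename⁺ (λ { zero → refl ; (suc i) → h i }) φ x
sat-rename⁺ h (all φ) x a = sat-rename⁺ (λ { zero → refl ; (suc i) → h i }) φ (x a)

sat-rename⁻ h tt        x = x
sat-rename⁻ h (eq i j)  x = trans (≡-sym (h i)) (trans x (h j))
sat-rename⁻ {M} h (rel i j) x = trans (≡-sym (cong₂ (edge M) (h i) (h j))) x
sat-rename⁻ h (not φ)   x = x ∘ sat-rename⁺ h φ
sat-rename⁻ h (φ and ψ) (x , y) = sat-rename⁻ h φ x , sat-rename⁻ h ψ y
sat-rename⁻ h (φ or ψ)  x = Sum.map (sat-rename⁻ h φ) (sat-rename⁻ h ψ) x
sat-rename⁻ h (φ imp ψ) x = sat-rename⁻ h ψ ∘ x ∘ sat-rename⁺ h φ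
sat-rename⁻ h (ex φ) (a , x) = a , sat-rename⁻ (λ { zero → refl ; (suc i) → h i }) φ x
sat-rename⁻ h (all φ) x a = sat-rename⁻ (λ { zero → refl ; (suc i) → h i }) φ (x a)

module _ {M : Graph} {n} {ρ : Vector ℕ n} where

  sat-⋀⁻ : ∀ {A : Set} (f : A → Formula n) xs → Sat M ρ (foldr _and_ tt (map f xs)) →
    ∀ {x} → x ∈ˡ xs → Sat M ρ (f x)
  sat-⋀⁻ f (x ∷ xs) (s , _) (here refl) = s
  sat-⋀⁻ f (x ∷ xs) (_ , s) (there x∈)  = sat-⋀⁻ f xs s x∈

  sat-⋀⁺ : ∀ {A : Set} (f : A → Formula n) xs → (∀ x → Sat M ρ (f x)) →
    Sat M ρ (foldr _and_ tt (map f xs))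
  sat-⋀⁺ f []       s = tt
  sat-⋀⁺ f (x ∷ xs) s = s x , sat-⋀⁺ f xs s

  ∈-pairs : ∀ (i j : Fin n) → (i , j) ∈ˡ pairs n
  ∈-pairs i j = ∈-concat⁺′ (∈-map⁺ (i ,_) (∈-allFin j))
    (∈-map⁺ (λ i → map (i ,_) (allFin n)) (∈-allFin i))

  diag-edge : ∀ (G : FinGraph n) → Sat M ρ (diag G) → ∀ i j → edge M (ρ i) (ρ j) ≡ adj G i j
  diag-edge G s i j with adj G i j | sat-⋀⁻ _ (pairs n) s (∈-pairs i j)
  ... | true  | e , _ = e
  ... | false | e , _ = ≢true⇒≡false e

  diag-injective : ∀ (G : FinGraph n) → Sat M ρ (diag G) → Injective _≡_ _≡_ ρ
  diag-injective G s {i} {j} h with i Fin.≟ j | sat-⋀⁻ _ (pairs n) s (∈-pairs i j)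
  ... | yes p | _ = p
  ... | no _  | _ , ne = ⊥-elim (ne h)

  diag-sat : ∀ (G : FinGraph n) → (∀ i j → edge M (ρ i) (ρ j) ≡ adj G i j) → Injective _≡_ _≡_ ρ →
    Sat M ρ (diag G)
  diag-sat G iso inj = sat-⋀⁺ _ (pairs n) λ (i , j) → edge-lit i j , eq-lit i j
    where
    edge-lit : ∀ i j → Sat M ρ (if adj G i j then rel i j else not (rel i j))
    edge-lit i j with adj G i j | iso i j
    ... | true  | e = e
    ... | false | e = λ f → false≢true (trans (≡-sym e) f)
    eq-lit : ∀ i j → Sat M ρ (if does (i Fin.≟ j) then eq i j else not (eq i j))
    eq-lit i j with i Fin.≟ j
    ... | yes p = cong ρ p
    ... | no ¬p = ¬p ∘ inj

-- The number of local rounds that decides a formula; at a quantifier, `extend` turns `2r + 1`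
-- rounds into one free move and `r` rounds.
rank : ∀ {n} → Formula n → ℕ
rank tt        = 0
rank ff        = 0
rank (eq _ _)  = 0
rank (rel _ _) = 0
rank (not φ)   = rank φ
rank (φ and ψ) = rank φ ⊔ rank ψ
rank (φ or ψ)  = rank φ ⊔ rank ψ
rank (φ imp ψ) = rank φ ⊔ rank ψ
rank (ex φ)    = suc (rank φ) + rank φ
rank (all φ)   = suc (rank φ) + rank φ

E-≤ : ∀ {M M′ r r′ P} → r ≤ r′ → E M M′ r′ P → E M M′ r P
E-≤ {M} {M′} {r} {r′} {P} r≤ h = E-drop (r′ ∸ r) (subst (λ l → E M M′ l P) (≡-sym (m∸n+n≡m r≤)) h)

module ClosureTypes (em : ExcludedMiddle 0ℓ) (α : Alpha) where

  open Equivalence using (to; from)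

  graphsWith : ∀ {n} → (Fin n → Fin n → Bool) → List (FinGraph n)
  graphsWith f with em {∀ i j → f i j ≡ f j i} | em {∀ i → f i i ≡ false}
  ... | yes s | yes r = record { adj = f ; sym = s ; irrefl = r } ∷ []
  ... | _     | _     = []

  graphs : ∀ n → List (FinGraph n)
  graphs n = concatMap graphsWith (functions n (functions n (true ∷ false ∷ [])))

  graphs-complete : ∀ {n} (G : FinGraph n) → ∃ λ H → H ∈ˡ graphs n × (∀ i j → adj H i j ≡ adj G i j)
  graphs-complete {n} G
    with functions-complete n (functions n (true ∷ false ∷ [])) (λ i row → ∀ j → row j ≡ adj G i j)
           (λ i → functions-complete n (true ∷ false ∷ []) (λ j b → b ≡ adj G i j) λ j → entry (adj G i j))
    where
    entry : ∀ b → ∃ λ b′ → b′ ∈ˡ (true ∷ false ∷ []) × b′ ≡ b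
    entry true  = true , here refl , refl
    entry false = false , there (here refl) , refl
  ... | f , f∈ , f≡ = let H , H∈ , H≡ = found in
    H , ∈-concat⁺′ H∈ (∈-map⁺ graphsWith f∈) , λ i j → trans (H≡ i j) (f≡ i j)
    where
    found : ∃ λ H → H ∈ˡ graphsWith f × (∀ i j → adj H i j ≡ f i j)
    found with em {∀ i j → f i j ≡ f j i} | em {∀ i → f i i ≡ false}
    ... | yes s | yes r = _ , here refl , λ _ _ → refl
    ... | no ¬s | _     = ⊥-elim (¬s λ i j → trans (f≡ i j) (trans (FinGraph.sym G i j) (≡-sym (f≡ j i))))
    ... | yes _ | no ¬r = ⊥-elim (¬r λ i → trans (f≡ i i) (irrefl G i))

  Model : ℕ → Set
  Model n = Σ Graph λ M → Generic α M × Vector ℕ n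

  infix 4 _⊨_
  _⊨_ : ∀ {n} → Model n → Formula n → Set
  (M , _ , ρ) ⊨ φ = Sat M ρ φ

  ClosureFormula : ℕ → Set
  ClosureFormula n = Σ (Formula n) (IsClosure α)

  Agree : ∀ {n} → List (ClosureFormula n) → Model n → Model n → Set
  Agree Θ p q = ∀ {θ} → θ ∈ˡ Θ → (p ⊨ proj₁ θ) ⇔ (q ⊨ proj₁ θ)

  -- `R` compares two models, so it is controlled by a finite list whose truth values force it; a
  -- single formula is extracted only at the end.
  Definable : ∀ {n} → (Model n → Model n → Set) → Set
  Definable {n} R = Σ (List (ClosureFormula n)) λ Θ → ∀ p q → Agree Θ p q → R p q

  -- `P` collects the side conditions that make `φ` a closure formula; where they fail, nothing is
  -- required.
  definable-formula : ∀ {n} {P : Set} (φ : Formula n) → (P → IsClosure α φ) →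
    Definable (λ p q → P → (p ⊨ φ) ⇔ (q ⊨ φ))
  definable-formula {P = P} φ closure with em {P}
  ... | yes c = (φ , closure c) ∷ [] , λ p q agree _ → agree (here refl)
  ... | no ¬c = [] , λ p q agree c → ⊥-elim (¬c c)

  definable-∀ : ∀ {n} {A : Set} (xs : List A) {R : A → Model n → Model n → Set} →
    (∀ x → Definable (R x)) → Definable (λ p q → ∀ {x} → x ∈ˡ xs → R x p q)
  definable-∀ xs d = concatMap (proj₁ ∘ d) xs , λ p q agree {x} x∈ →
    proj₂ (d x) p q (λ θ∈ → agree (∈-concat⁺′ θ∈ (∈-map⁺ (proj₁ ∘ d) x∈)))

  definable-× : ∀ {n} {R S : Model n → Model n → Set} → Definable R → Definable S →
    Definable (λ p q → R p q × S p q)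
  definable-× (Θ , r) (Ξ , s) = Θ List.++ Ξ , λ p q agree →
    r p q (agree ∘ ∈-++⁺ˡ) , s p q (agree ∘ ∈-++⁺ʳ Θ)

  definable-map : ∀ {n} {R S : Model n → Model n → Set} → (∀ p q → R p q → S p q) →
    Definable R → Definable S
  definable-map f (Θ , r) = Θ , λ p q agree → f p q (r p q agree)

  -- The conjunctions over all choices of signs, that is, the atoms of the Boolean algebra generated
  -- by the list.
  types : ∀ {n} → List (ClosureFormula n) → List (ClosureFormula n)
  types []            = (tt , ctt) ∷ []
  types ((φ , c) ∷ Θ) =
    map (λ (τ , t) → φ and τ , cand c t) (types Θ) List.++
    map (λ (τ , t) → not φ and τ , cand (cnot c) t) (types Θ)

  types-cover : ∀ {n} Θ (p : Model n) → ∃ λ τ → τ ∈ˡ types Θ × p ⊨ proj₁ τ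
  types-cover []            p = _ , here refl , tt
  types-cover ((φ , c) ∷ Θ) p with em {p ⊨ φ} | types-cover Θ p
  ... | yes s | τ , τ∈ , t = _ , ∈-++⁺ˡ (∈-map⁺ _ τ∈) , s , t
  ... | no ¬s | τ , τ∈ , t = _ , ∈-++⁺ʳ (map (λ (τ , t) → φ and τ , cand c t) (types Θ)) (∈-map⁺ _ τ∈) , ¬s , t

  types-agree : ∀ {n} Θ {τ} (p q : Model n) → τ ∈ˡ types Θ → p ⊨ proj₁ τ → q ⊨ proj₁ τ → Agree Θ p q
  types-agree ((φ , c) ∷ Θ) p q τ∈ s t θ∈
    with ∈-++⁻ (map (λ (τ , t) → φ and τ , cand c t) (types Θ)) τ∈
  types-agree ((φ , c) ∷ Θ) p q τ∈ s t θ∈ | inj₁ τ∈′ with ∈-map⁻ _ τ∈′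
  types-agree ((φ , c) ∷ Θ) p q τ∈ (s , _) (t , _) (here refl)   | inj₁ _ | _ , _ , refl = mk⇔ (λ _ → t) (λ _ → s)
  types-agree ((φ , c) ∷ Θ) p q τ∈ (_ , s) (_ , t) (there θ∈) | inj₁ _ | _ , σ∈ , refl =
    types-agree Θ p q σ∈ s t θ∈
  types-agree ((φ , c) ∷ Θ) p q τ∈ s t θ∈ | inj₂ τ∈′ with ∈-map⁻ _ τ∈′
  types-agree ((φ , c) ∷ Θ) p q τ∈ (s , _) (t , _) (here refl)   | inj₂ _ | _ , _ , refl = mk⇔ (⊥-elim ∘ s) (⊥-elim ∘ t)
  types-agree ((φ , c) ∷ Θ) p q τ∈ (_ , s) (_ , t) (there θ∈) | inj₂ _ | _ , σ∈ , refl =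
    types-agree Θ p q σ∈ s t θ∈

  Game : ∀ {n} → ℕ → Model n → Model n → Set
  Game r (M , _ , ρ) (M′ , _ , ρ′) = E M M′ r (graph ρ ρ′)

  game-sym : ∀ {n} r (p q : Model n) → Game r p q → Game r q p
  game-sym r p q h = E-⊆ r (λ (i , x , y) → i , y , x) (E-sym r h)

  PairAtomic : ∀ {n} → Fin n → Fin n → Model n → Model n → Set
  PairAtomic i j (M , _ , ρ) (M′ , _ , ρ′) =
    (ρ i ≡ ρ j → ρ′ i ≡ ρ′ j) × (ρ′ i ≡ ρ′ j → ρ i ≡ ρ j) × edge M (ρ i) (ρ j) ≡ edge M′ (ρ′ i) (ρ′ j)

  atomic : ∀ {n} (p q : Model n) → (∀ i j → PairAtomic i j p q) → Game 0 p q
  atomic p q h = record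
    { to     = λ { (i , refl , refl) (j , refl , refl) → proj₁ (h i j) }
    ; from   = λ { (i , refl , refl) (j , refl , refl) → proj₁ (proj₂ (h i j)) }
    ; edges≡ = λ { (i , refl , refl) (j , refl , refl) → proj₂ (proj₂ (h i j)) } }

  module _ {n} (i j : Fin n) (i≢j : i ≢ j) where

    two : Fin 2 → Fin n
    two = i ◂ (j ◂ λ ())

    two-injective : ∀ {A : Set} (f : Fin n → A) → f i ≢ f j → Injective _≡_ _≡_ (f ∘ two)
    two-injective f h {zero}     {zero}     _ = refl
    two-injective f h {zero}     {suc zero} e = ⊥-elim (h e)
    two-injective f h {suc zero} {zero}     e = ⊥-elim (h (≡-sym e))
    two-injective f h {suc zero} {suc zero} _ = refl

    TwoAgree : Model n → Model n → Set
    TwoAgree p q = ∀ {G} → G ∈ˡ graphs 2 → K α G →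
      (p ⊨ rename two (diag G)) ⇔ (q ⊨ rename two (diag G))

    distinct-pair : ∀ p q → TwoAgree p q →
      let M , _ , ρ = p ; M′ , _ , ρ′ = q in
      ρ i ≢ ρ j → ρ′ i ≢ ρ′ j × edge M (ρ i) (ρ j) ≡ edge M′ (ρ′ i) (ρ′ j)
    distinct-pair (M , gen , ρ) (M′ , gen′ , ρ′) agree ≢ρ with graphs-complete (induced M (ρ ∘ two))
    ... | G , G∈ , G≡ = (λ h → 0≢1 (diag-injective G sat′ h)) ,
      trans (≡-sym (G≡ zero (suc zero))) (≡-sym (diag-edge G sat′ zero (suc zero)))
      where
      0≢1 : zero ≢ suc {1} zero
      0≢1 ()
      inj : Injective _≡_ _≡_ (ρ ∘ two)
      inj = two-injective ρ ≢ρ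
      sat′ : Sat M′ (ρ′ ∘ two) (diag G)
      sat′ = sat-rename⁻ (λ _ → refl) (diag G)
        (to (agree G∈ (K-cong α G≡ (Generic.age gen 2 _ inj)))
          (sat-rename⁺ (λ _ → refl) (diag G) (diag-sat G (λ a b → ≡-sym (G≡ a b)) inj)))

    -- Diagrams speak of distinct vertices only, so equality shows as the failure of every
    -- two-vertex diagram. For distinct vertices, `age` puts the diagram in `K`.
    two-atomic : ∀ p q → TwoAgree p q → PairAtomic i j p q
    two-atomic p@(M , _ , ρ) q@(M′ , _ , ρ′) agree with ρ i ≟ ρ j | ρ′ i ≟ ρ′ j
    ... | no h   | _      = let h′ , e = distinct-pair p q agree h in ⊥-elim ∘ h , ⊥-elim ∘ h′ , e
    ... | yes h  | no h′  = ⊥-elim (proj₁ (distinct-pair q p (λ G∈ k → ⇔.sym (agree G∈ k)) h′) h)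
    ... | yes h  | yes h′ = (λ _ → h′) , (λ _ → h) , trans (loop M h) (≡-sym (loop M′ h′))
      where
      loop : ∀ M {x y} → x ≡ y → edge M x y ≡ false
      loop M refl = eirrefl M _

  pair-definable : ∀ {n} (i j : Fin n) → Definable (PairAtomic i j)
  pair-definable i j with i Fin.≟ j
  ... | yes refl = [] , λ (M , _ , _) (M′ , _ , _) _ → (λ _ → refl) , (λ _ → refl) ,
          trans (eirrefl M _) (≡-sym (eirrefl M′ _))
  ... | no i≢j   = definable-map {R = TwoAgree i j i≢j} (two-atomic i j i≢j)
    (definable-∀ (graphs 2) λ G → definable-formula (rename (two i j i≢j) (diag G))
      λ k → ren (two i j i≢j) (two-injective i j i≢j id i≢j) (diag G) (cdiag G k))

  -- The quantifier is relativised over a subtuple named by `s`, because `diag` forces distinct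
  -- values and an assignment may repeat some. `τ` describes the rounds that remain.
  StepAgree : ∀ {n} → ℕ → (∀ k → List (ClosureFormula (suc k))) → Model n → Model n → Set
  StepAgree {n} r Τ p q = ∀ {k} → k ∈ˡ upTo (suc n) → ∀ {s} → s ∈ˡ functions k (allFin n) →
    ∀ {B} → B ∈ˡ graphs (suc k) → ∀ {τ} → τ ∈ˡ Τ k →
    Injective _≡_ _≡_ s × K α B × Intrinsic 1 k B →
    (p ⊨ rename s (ex (diag B and proj₁ τ))) ⇔ (q ⊨ rename s (ex (diag B and proj₁ τ)))

  step-forth : ∀ {n} r (d : ∀ k → Definable {suc k} (Game r)) (p q : Model n) →
    Game r p q → StepAgree r (types ∘ proj₁ ∘ d) p q →
    let M , _ , ρ = p ; M′ , _ , ρ′ = q in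
    ∀ {x x′} → graph ρ ρ′ x x′ → ∀ y → edge M x y ≡ true → ∃ λ y′ → E M M′ r (Ext (graph ρ ρ′) y y′)
  step-forth {n} r d (M , gen , ρ) (M′ , gen′ , ρ′) game agree (i , refl , refl) y e
    with Finₚ.any? (λ j → ρ j ≟ y)
  ... | yes (j , refl) = ρ′ j , E-⊆ r (λ { (inj₁ (refl , refl)) → j , refl , refl ; (inj₂ g) → g }) game
  ... | no ¬old
    with k , k≤n , s₀ , inj₀ , cover₀ ← dedup ρ
    with s , s∈ , s≡ ← functions-complete k (allFin n) (λ i x → x ≡ s₀ i) (λ i → s₀ i , ∈-allFin _ , refl)
    with B , B∈ , B≡ ← graphs-complete (induced M (y ◂ (ρ ∘ s)))
    with τ , τ∈ , sat ← types-cover (proj₁ (d k)) (M , gen , y ◂ (ρ ∘ s))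
    = finish (sat-rename⁻ (λ _ → refl) (ex (diag B and proj₁ τ)) (to
        (agree (∈-upTo⁺ (s≤s k≤n)) s∈ B∈ τ∈
          ((λ h → inj (cong ρ h)) , K-cong α B≡ (Generic.age gen _ _ inj◂) , intrinsic))
        (sat-rename⁺ (λ _ → refl) (ex (diag B and proj₁ τ))
          (y , diag-sat B (λ a b → ≡-sym (B≡ a b)) inj◂ , sat))))
    where
    inj : Injective _≡_ _≡_ (ρ ∘ s)
    inj {a} {b} h = inj₀ (trans (cong ρ (≡-sym (s≡ a))) (trans h (cong ρ (s≡ b))))
    cover : ∀ j → ∃ λ i → ρ (s i) ≡ ρ j
    cover j = let i , h = cover₀ j in i , trans (cong ρ (s≡ i)) h
    inj◂ : Injective _≡_ _≡_ (y ◂ (ρ ∘ s))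
    inj◂ = ◂-injective inj λ j h → ¬old (s j , h)
    intrinsic : Intrinsic 1 k B
    intrinsic = let i₀ , h = cover i in neighbour-intrinsic B {i₀}
      (trans (B≡ zero (suc i₀)) (edge-sym {M} (trans (cong (λ z → edge M z y) h) e)))
    finish : (∃ λ y′ → Sat M′ (y′ ◂ (ρ′ ∘ s)) (diag B and proj₁ τ)) →
      ∃ λ y′ → E M M′ r (Ext (graph ρ ρ′) y y′)
    finish (y′ , _ , sat′) = y′ , E-⊆ r
      (λ { (inj₁ (refl , refl)) → zero , refl , refl
         -- A repeated value of `ρ` is kept at one index only; its partners in `ρ′` coincide because
         -- `game` is atomic.
         ; (inj₂ (j , refl , refl)) → let i , h = cover j in suc i , h ,
             Atomic.to (E-atomic r game) (s i , refl , refl) (j , refl , refl) h })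
      (proj₂ (d k) (M , gen , y ◂ (ρ ∘ s)) (M′ , gen′ , y′ ◂ (ρ′ ∘ s))
        (types-agree (proj₁ (d k)) (M , gen , y ◂ (ρ ∘ s)) (M′ , gen′ , y′ ◂ (ρ′ ∘ s)) τ∈ sat sat′))

  game-definable : ∀ r n → Definable {n} (Game r)
  game-definable zero n = definable-map (λ p q h → atomic p q λ i j → h (∈-allFin i) (∈-allFin j))
    (definable-∀ (allFin n) λ i → definable-∀ (allFin n) λ j → pair-definable i j)
  game-definable (suc r) n = definable-map {R = λ p q → Game r p q × StepAgree r (types ∘ proj₁ ∘ d) p q}
    (λ p q (game , agree) → E-atomic r game , (λ {x} {x′} → step-forth r d p q game agree {x} {x′}) ,
      λ { (i , x , x′) y′ e →
        let y , h = step-forth r d q p (game-sym r p q game)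
                      (λ k∈ s∈ B∈ τ∈ c → ⇔.sym (agree k∈ s∈ B∈ τ∈ c)) (i , x′ , x) y′ e
        in y , E-⊆ r (λ { (inj₁ (a , b)) → inj₁ (b , a) ; (inj₂ (i , a , b)) → inj₂ (i , b , a) }) (E-sym r h) })
    -- `Game r` answers a move to a vertex already in play, which uses up a round without changing
    -- the position.
    (definable-× (game-definable r n)
      (definable-∀ (upTo (suc n)) λ k → definable-∀ (functions k (allFin n)) λ s →
        definable-∀ (graphs (suc k)) λ B → definable-∀ (types (proj₁ (d k))) λ (τ , cτ) →
        definable-formula (rename s (ex (diag B and τ)))
          λ (inj , kB , int) → ren s inj _ (cex 1 k B kB int τ cτ)))
    where
    d : ∀ k → Definable {suc k} (Game r)
    d k = game-definable r (suc k)

  -- Transfer of formulas and the eliminating disjunction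

  preserves : ∀ {n} (φ : Formula n) p q → Game (rank φ) p q → p ⊨ φ → q ⊨ φ
  preserves tt        p q h s = s
  preserves (eq i j)  p q h s = Atomic.to h (i , refl , refl) (j , refl , refl) s
  preserves (rel i j) p q h s = trans (≡-sym (Atomic.edges≡ h (i , refl , refl) (j , refl , refl))) s
  preserves (not φ)   p q h s = s ∘ preserves φ q p (game-sym (rank φ) p q h)
  preserves (φ and ψ) p q h (s , t) =
    preserves φ p q (E-≤ (m≤m⊔n _ _) h) s , preserves ψ p q (E-≤ (m≤n⊔m (rank φ) _) h) t
  preserves (φ or ψ)  p q h s =
    Sum.map (preserves φ p q (E-≤ (m≤m⊔n _ _) h)) (preserves ψ p q (E-≤ (m≤n⊔m (rank φ) _) h)) s
  preserves (φ imp ψ) p q h s =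
    preserves ψ p q (E-≤ (m≤n⊔m (rank φ) _) h) ∘ s ∘
    preserves φ q p (game-sym (rank φ) p q (E-≤ (m≤m⊔n _ _) h))
  preserves (ex φ)  (M , gen , ρ) (M′ , gen′ , ρ′) h (a , s) =
    let a′ , h′ = extend em gen gen′ (rank φ) h a
    in a′ , preserves φ (M , gen , a ◂ ρ) (M′ , gen′ , a′ ◂ ρ′) h′ s
  preserves (all φ) p@(M , gen , ρ) q@(M′ , gen′ , ρ′) h s a′ =
    let a , h′ = extend em gen′ gen (rank φ) (game-sym (rank (all φ)) p q h) a′
    in preserves φ (M , gen , a ◂ ρ) (M′ , gen′ , a′ ◂ ρ′)
         (game-sym (rank φ) (M′ , gen′ , a′ ◂ ρ′) (M , gen , a ◂ ρ) h′) (s a)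

  -- The realisation may lie in any generic graph, so the disjunction built from it does not depend
  -- on the graph.
  Realised : ∀ {n} → Formula n → ClosureFormula n → Set
  Realised φ (τ , _) = ∃ λ p → p ⊨ τ × p ⊨ φ

  disjoin : ∀ {n} → Formula n → List (ClosureFormula n) → ClosureFormula n
  disjoin φ []       = ff , cff
  disjoin φ (τ ∷ Τ) with em {Realised φ τ}
  ... | yes _ = proj₁ τ or proj₁ (disjoin φ Τ) , cor (proj₂ τ) (proj₂ (disjoin φ Τ))
  ... | no _  = disjoin φ Τ

  disjoin⁺ : ∀ {n} (φ : Formula n) Τ {τ} p → τ ∈ˡ Τ → p ⊨ proj₁ τ → p ⊨ φ → p ⊨ proj₁ (disjoin φ Τ)
  disjoin⁺ φ (τ ∷ Τ) p τ∈ s t with em {Realised φ τ}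
  disjoin⁺ φ (τ ∷ Τ) p (here refl) s t | yes _ = inj₁ s
  disjoin⁺ φ (τ ∷ Τ) p (there τ∈)  s t | yes _ = inj₂ (disjoin⁺ φ Τ p τ∈ s t)
  disjoin⁺ φ (τ ∷ Τ) p (here refl) s t | no ¬r = ⊥-elim (¬r (p , s , t))
  disjoin⁺ φ (τ ∷ Τ) p (there τ∈)  s t | no _  = disjoin⁺ φ Τ p τ∈ s t

  disjoin⁻ : ∀ {n} (φ : Formula n) Τ p → p ⊨ proj₁ (disjoin φ Τ) →
    ∃ λ τ → τ ∈ˡ Τ × p ⊨ proj₁ τ × Realised φ τ
  disjoin⁻ φ (τ ∷ Τ) p s with em {Realised φ τ}
  disjoin⁻ φ (τ ∷ Τ) p (inj₁ s) | yes r = τ , here refl , s , r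
  disjoin⁻ φ (τ ∷ Τ) p (inj₂ s) | yes _ = let σ , σ∈ , rest = disjoin⁻ φ Τ p s in σ , there σ∈ , rest
  disjoin⁻ φ (τ ∷ Τ) p s        | no _  = let σ , σ∈ , rest = disjoin⁻ φ Τ p s in σ , there σ∈ , rest

theorem3p7 : ExcludedMiddle 0ℓ → (α : Alpha) → ∀ {n} (φ : Formula n) →
    Σ (Formula n) λ ψ → IsClosure α ψ ×
    ((M : Graph) → Generic α M → (ρ : Vector ℕ n) → Sat M ρ φ ⇔ Sat M ρ ψ)
theorem3p7 em α {n} φ with ClosureTypes.game-definable em α (rank φ) n
... | Θ , determines = proj₁ ψ , proj₂ ψ , λ M gen ρ → let p = M , gen , ρ in mk⇔
  (λ s → let τ , τ∈ , t = types-cover Θ p in disjoin⁺ φ (types Θ) p τ∈ t s)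
  -- The type that holds at `p` also holds at some `q` satisfying `φ`; sharing it yields the game of
  -- length `rank φ`, which carries `φ` from `q` to `p`.
  (λ s → let τ , τ∈ , t , q , t′ , s′ = disjoin⁻ φ (types Θ) p s in
    preserves φ q p (determines q p (types-agree Θ q p τ∈ t′ t)) s′)
  where
  open ClosureTypes em α
  ψ : ClosureFormula n
  ψ = disjoin φ (types Θ)
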